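{- Let $d\ge1$ be an integer. Let $\Lambda_d^{(1)}$ be the $\mathbb{Q}$-vector space of symmetric polynomials in $x_1,\dots,x_d$ whose degree in each variable does not exceed $1$, regarded as an $\mathfrak{sl}_2$-module via $$\mathfrak{e}_+\mapsto\sum_{k=1}^d\Big(-x_k^2\frac{\partial}{\partial x_k}+x_k\Big),\qquad \mathfrak{h}\mapsto2\sum_{k=1}^d x_k\frac{\partial}{\partial x_k}-d,\qquad \mathfrak{e}_-\mapsto\sum_{k=1}^d\frac{\partial}{\partial x_k}.$$ Put $$w_0=e_0=1,\qquad w_i=\frac{i!}{(d-(i-1))(d-(i-2))\cdots d}\,e_i,\quad i=1,\dots,d,$$ where $e_i$ are the elementary symmetric polynomials in $x_1,\dots,x_d$. Then $\Lambda_d^{(1)}$ is a realization of the standard finite-dimensional $\mathfrak{sl}_2$-module $V_d$ with basis $w_0,\dots,w_d$; that is, $w_0,\dots,w_d$ is a basis of $\Lambda_d^{(1)}$ and the linear map $V_d\to\Lambda_d^{(1)}$, $v_i\mapsto w_i$, is an isomorphism of $\mathfrak{sl}_2$-modules.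
   Context: $\mathfrak{sl}_2$ has basis $\mathfrak{e}_-,\mathfrak{h},\mathfrak{e}_+$ with $[\mathfrak{h},\mathfrak{e}_+]=2\mathfrak{e}_+$, $[\mathfrak{h},\mathfrak{e}_-]=-2\mathfrak{e}_-$, $[\mathfrak{e}_+,\mathfrak{e}_-]=\mathfrak{h}$; an $\mathfrak{sl}_2$-module is a $\mathbb{Q}$-vector space with three endomorphisms (the images of these basis elements) satisfying these relations. The operators above preserve $\Lambda_d^{(1)}$ and satisfy the relations. $V_d$ denotes the standard irreducible $\mathfrak{sl}_2$-module with basis $v_0,\dots,v_d$ and action $\mathfrak{e}_+v_i=(d-i)v_{i+1}$, $\mathfrak{h}v_i=(2i-d)v_i$, $\mathfrak{e}_-v_i=i\,v_{i-1}$ (with $v_{ -1}=v_{d+1}=0$). -}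

module Defs where

open import Algebra.Bundles using (CommutativeRing; Monoid)
open import Algebra.Module.Bundles using (LeftModule)
open import Algebra.Module.Morphism.Structures
  using (IsLeftModuleHomomorphism; IsLeftModuleIsomorphism; IsLeftModuleMonomorphism)
open import Algebra.Module.Bundles.Raw using (RawLeftModule)
import Algebra.Definitions.RawMonoid as RawMonoidSum
import Algebra.Module.Morphism.LeftModuleMonomorphism as LeftModuleMonomorphism
import Algebra.Properties.AbelianGroup as AbelianGroupProperties
import Algebra.Properties.CommutativeMonoid.Sum as CommutativeMonoidSum
open import Data.Bool.Base using (if_then_else_; true; false)
open import Data.Fin.Base using (Fin; zero; suc; toℕ; inject₁; fromℕ<)
import Data.Fin.Properties as Finₚ
open import Data.Fin.Permutation using (Permutation′; _⟨$⟩ʳ_; _⟨$⟩ˡ_; inverseˡ; inverseʳ)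
open import Data.Fin.Subset using (Subset; inside; outside; ∣_∣)
open import Data.Integer.Base as ℤ using (ℤ; +_; -[1+_])
import Data.Integer.Properties as ℤₚ
open import Data.Integer.Solver using () renaming (module +-*-Solver to ℤ-Solver)
open import Data.List.Base as List using (List; []; _∷_; _++_; cartesianProductWith; filter)
import Data.List.Properties as Listₚ
open import Data.Nat.Base as ℕ using (ℕ; zero; suc; pred; NonZero; z≤n; s≤s; _!)
open import Data.Nat.Combinatorics.Base using (_P′_)
import Data.Nat.Properties as ℕₚ
open import Data.Product.Base using (Σ; _×_; _,_; proj₁; proj₂; Σ-syntax; ∃-syntax)
open import Data.Rational.Base as ℚ using (ℚ; 0ℚ; 1ℚ; _+_; _*_; -_; _-_; _/_)
import Data.Rational.Properties as ℚₚ
open import Data.Rational.Solver using () renaming (module +-*-Solver to ℚ-Solver)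
import Data.Rational.Unnormalised.Base as ℚᵘ
import Data.Rational.Unnormalised.Properties as ℚᵘₚ
open import Data.Sum.Base using (_⊎_; inj₁; inj₂)
open import Data.Vec.Base as Vec using (Vec; []; _∷_; lookup; tabulate; updateAt; zipWith; replicate)
import Data.Vec.Properties as Vecₚ
open import Function.Base using (_∘_; id; const; case_of_)
open import Level using (0ℓ)
open import Relation.Binary.PropositionalEquality
  using (_≡_; _≢_; _≗_; refl; sym; trans; cong; cong₂; subst; module ≡-Reasoning)
open import Relation.Nullary using (Dec; yes; no; does; contradiction)
open import Relation.Nullary.Decidable using (dec-true; dec-false)

open import Algebra.Properties.Semiring.Sum
  (CommutativeRing.semiring ℚₚ.+-*-commutativeRing)
  using (sum; sum-cong-≗; ∑-comm; ∑-distrib-+; *-distribˡ-sum; sum-permute)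

open ≡-Reasoning

-- Over the commutative ring ℚ, one-sided modules suffice.
VectorSpace : Set₁
VectorSpace = LeftModule ℚₚ.+-*-ring 0ℓ 0ℓ

fromℤ : ℤ → ℚ
fromℤ i = i / 1

fromℕ : ℕ → ℚ
fromℕ n = fromℤ (+ n)

IsLinear : (M N : VectorSpace) → (LeftModule.Carrierᴹ M → LeftModule.Carrierᴹ N) → Set
IsLinear M N = IsLeftModuleHomomorphism (LeftModule.rawLeftModule M) (LeftModule.rawLeftModule N)

module _ (M : VectorSpace) where
  open LeftModule M

  linearCombination : ∀ {n} → (Fin n → Carrierᴹ) → (Fin n → ℚ) → Carrierᴹ
  linearCombination b c = RawMonoidSum.sum +ᴹ-rawMonoid λ i → c i *ₗ b i

  record IsBasis {n} (b : Fin n → Carrierᴹ) : Set where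
    field
      independent : ∀ c → linearCombination b c ≈ᴹ 0ᴹ → ∀ i → c i ≡ 0ℚ
      spanning    : ∀ x → ∃[ c ] x ≈ᴹ linearCombination b c

record Sl₂Module : Set₁ where
  field
    vectorSpace : VectorSpace

  open LeftModule vectorSpace public

  field
    e₊ h e₋   : Carrierᴹ → Carrierᴹ
    e₊-linear : IsLinear vectorSpace vectorSpace e₊
    h-linear  : IsLinear vectorSpace vectorSpace h
    e₋-linear : IsLinear vectorSpace vectorSpace e₋
    [h,e₊]    : ∀ x → h (e₊ x) +ᴹ -ᴹ e₊ (h x) ≈ᴹ fromℕ 2 *ₗ e₊ x
    [h,e₋]    : ∀ x → h (e₋ x) +ᴹ -ᴹ e₋ (h x) ≈ᴹ (- fromℕ 2) *ₗ e₋ x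
    [e₊,e₋]   : ∀ x → e₊ (e₋ x) +ᴹ -ᴹ e₋ (e₊ x) ≈ᴹ h x

record IsSl₂Isomorphism (M N : Sl₂Module)
                        (φ : Sl₂Module.Carrierᴹ M → Sl₂Module.Carrierᴹ N) : Set where
  private
    module M = Sl₂Module M
    module N = Sl₂Module N
  field
    isLinearIsomorphism : IsLeftModuleIsomorphism M.rawLeftModule N.rawLeftModule φ
    e₊-equivariant      : ∀ x → φ (M.e₊ x) N.≈ᴹ N.e₊ (φ x)
    h-equivariant       : ∀ x → φ (M.h x) N.≈ᴹ N.h (φ x)
    e₋-equivariant      : ∀ x → φ (M.e₋ x) N.≈ᴹ N.e₋ (φ x)

Exponent : ℕ → Set
Exponent d = Vec ℕ d

Term : ℕ → Set
Term d = ℚ × Exponent d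

-- Finite formal sums of terms c x^α, identified by _≈_ below when all their
-- coefficients agree.
Poly : ℕ → Set
Poly d = List (Term d)

_≟ᴱ_ : ∀ {d} (α β : Exponent d) → Dec (α ≡ β)
_≟ᴱ_ = Vecₚ.≡-dec ℕₚ._≟_

coeff : ∀ {d} → Poly d → Exponent d → ℚ
coeff []            α = 0ℚ
coeff ((c , β) ∷ p) α = (if does (β ≟ᴱ α) then c else 0ℚ) + coeff p α

infix 4 _≈_
_≈_ : ∀ {d} → Poly d → Poly d → Set
p ≈ q = coeff p ≗ coeff q

infixr 7 _·_
_·_ : ∀ {d} → ℚ → Poly d → Poly d
a · p = List.map (λ (c , α) → a * c , α) p

neg : ∀ {d} → Poly d → Poly d
neg p = List.map (λ (c , α) → - c , α) p

_⊗ᵗ_ : ∀ {d} → Term d → Term d → Term d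
(c , α) ⊗ᵗ (b , β) = c * b , zipWith ℕ._+_ α β

infixl 7 _⊗_
_⊗_ : ∀ {d} → Poly d → Poly d → Poly d
_⊗_ = cartesianProductWith _⊗ᵗ_

X : ∀ {d} → Fin d → Poly d
X {d} k = (1ℚ , updateAt (replicate d 0) k (const 1)) ∷ []

-- Truncation by `pred` is harmless: if α_k = 0 then the new coefficient is 0.
∂ : ∀ {d} → Fin d → Poly d → Poly d
∂ k p = List.map (λ (c , α) → fromℕ (lookup α k) * c , updateAt α k pred) p

∑ᴾ : ∀ {d n} → (Fin n → Poly d) → Poly d
∑ᴾ {d} = RawMonoidSum.sum (Monoid.rawMonoid (Listₚ.++-monoid (Term d)))

-- The substitution x_k ↦ x_{σ k}; the exponent of x_j becomes α_{σ⁻¹ j}.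
rename : ∀ {d} → Permutation′ d → Poly d → Poly d
rename σ p = List.map (λ (c , α) → c , tabulate λ j → lookup α (σ ⟨$⟩ˡ j)) p

IsSymmetric : ∀ {d} → Poly d → Set
IsSymmetric p = ∀ σ → rename σ p ≈ p

DegreeIn_≤_ : ∀ {d} → Fin d → ℕ → Poly d → Set
(DegreeIn k ≤ n) p = ∀ α → coeff p α ≢ 0ℚ → lookup α k ℕ.≤ n

polyE₊ polyH polyE₋ : ∀ {d} → Poly d → Poly d
polyE₊ p     = ∑ᴾ λ k → neg ((X k ⊗ X k) ⊗ ∂ k p) ++ X k ⊗ p
polyH  {d} p = fromℕ 2 · ∑ᴾ (λ k → X k ⊗ ∂ k p) ++ neg (fromℕ d · p)
polyE₋ p     = ∑ᴾ λ k → ∂ k p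

subsets : ∀ d → List (Subset d)
subsets zero    = [] ∷ []
subsets (suc d) = List.map (inside ∷_) (subsets d) ++ List.map (outside ∷_) (subsets d)

-- The exponent of the monomial ∏_{k ∈ S} x_k.
indicator : ∀ {d} → Subset d → Exponent d
indicator = Vec.map (if_then 1 else 0)

elementary : ∀ d → ℕ → Poly d
elementary d i =
  List.map (λ S → 1ℚ , indicator S) (filter (λ S → ∣ S ∣ ℕₚ.≟ i) (subsets d))

fromℤ-+ : ∀ i j → fromℤ (i ℤ.+ j) ≡ fromℤ i + fromℤ j
fromℤ-+ i j = ℚₚ.toℚᵘ-injective (ℚᵘₚ.≃-trans (ℚₚ.toℚᵘ-fromℚᵘ (ℚᵘ.mkℚᵘ (i ℤ.+ j) 0))
  (ℚᵘₚ.≃-trans (ℚᵘ.*≡* eq)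
  (ℚᵘₚ.≃-sym (ℚᵘₚ.≃-trans (ℚₚ.toℚᵘ-homo-+ (fromℤ i) (fromℤ j))
    (ℚᵘₚ.+-cong (ℚₚ.toℚᵘ-fromℚᵘ (ℚᵘ.mkℚᵘ i 0)) (ℚₚ.toℚᵘ-fromℚᵘ (ℚᵘ.mkℚᵘ j 0)))))))
  where
  eq : (i ℤ.+ j) ℤ.* + 1 ≡ (i ℤ.* + 1 ℤ.+ j ℤ.* + 1) ℤ.* + 1
  eq = cong (ℤ._* + 1) (sym (cong₂ ℤ._+_ (ℤₚ.*-identityʳ i) (ℤₚ.*-identityʳ j)))

fromℕ-suc : ∀ n → fromℕ (suc n) ≡ 1ℚ + fromℕ n
fromℕ-suc n = fromℤ-+ (+ 1) (+ n)

sum-0 : ∀ {n} (t : Fin n → ℚ) → (∀ i → t i ≡ 0ℚ) → sum t ≡ 0ℚ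
sum-0 {zero}  t t≡0 = refl
sum-0 {suc n} t t≡0 = cong₂ _+_ (t≡0 zero) (sum-0 (t ∘ suc) (t≡0 ∘ suc))

sum-single : ∀ {n} (t : Fin n → ℚ) k → (∀ j → j ≢ k → t j ≡ 0ℚ) → sum t ≡ t k
sum-single t zero    t≡0 =
  trans (cong (λ x → t zero + x) (sum-0 (t ∘ suc) λ i → t≡0 (suc i) λ ())) (ℚₚ.+-identityʳ _)
sum-single t (suc k) t≡0 =
  trans (cong₂ _+_ (t≡0 zero λ ())
                   (sum-single (t ∘ suc) k λ j j≢k → t≡0 (suc j) (j≢k ∘ Finₚ.suc-injective)))
        (ℚₚ.+-identityˡ _)

sum-neg : ∀ {n} (t : Fin n → ℚ) → sum (λ i → - t i) ≡ - sum t
sum-neg {zero}  t = refl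
sum-neg {suc n} t = trans (cong (λ x → - t zero + x) (sum-neg (t ∘ suc)))
                          (sym (ℚₚ.neg-distrib-+ (t zero) (sum (t ∘ suc))))

pointwise : Set → VectorSpace
pointwise A = record
  { Carrierᴹ     = A → ℚ
  ; _≈ᴹ_         = _≗_
  ; _+ᴹ_         = λ f g a → f a + g a
  ; _*ₗ_         = λ c f a → c * f a
  ; 0ᴹ           = λ _ → 0ℚ
  ; -ᴹ_          = λ f a → - f a
  ; isLeftModule = record
    { isLeftSemimodule = record
      { +ᴹ-isCommutativeMonoid = record
        { isMonoid = record
          { isSemigroup = record
            { isMagma = record
              { isEquivalence = record
                { refl  = λ _ → refl
                ; sym   = λ p a → sym (p a)
                ; trans = λ p q a → trans (p a) (q a)
                }
              ; ∙-cong = λ p q a → cong₂ _+_ (p a) (q a)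
              }
            ; assoc = λ f g h a → ℚₚ.+-assoc (f a) (g a) (h a)
            }
          ; identity = (λ f a → ℚₚ.+-identityˡ (f a)) , (λ f a → ℚₚ.+-identityʳ (f a))
          }
        ; comm = λ f g a → ℚₚ.+-comm (f a) (g a)
        }
      ; isPreleftSemimodule = record
        { *ₗ-cong      = λ p q a → cong₂ _*_ p (q a)
        ; *ₗ-zeroˡ     = λ f a → ℚₚ.*-zeroˡ (f a)
        ; *ₗ-distribʳ  = λ f c e a → ℚₚ.*-distribʳ-+ (f a) c e
        ; *ₗ-identityˡ = λ f a → ℚₚ.*-identityˡ (f a)
        ; *ₗ-assoc     = λ c e f a → ℚₚ.*-assoc c e (f a)
        ; *ₗ-zeroʳ     = λ c a → ℚₚ.*-zeroʳ c
        ; *ₗ-distribˡ  = λ c f g a → ℚₚ.*-distribˡ-+ c (f a) (g a)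
        }
      }
    ; -ᴹ‿cong    = λ p a → cong -_ (p a)
    ; -ᴹ‿inverse = (λ f a → ℚₚ.+-inverseˡ (f a)) , (λ f a → ℚₚ.+-inverseʳ (f a))
    }
  }

module _ (M N : VectorSpace) where
  private
    module M = LeftModule M
    module N = LeftModule N

  isLinear : (f : M.Carrierᴹ → N.Carrierᴹ) →
             (∀ {x y} → x M.≈ᴹ y → f x N.≈ᴹ f y) →
             (∀ x y → f (x M.+ᴹ y) N.≈ᴹ f x N.+ᴹ f y) →
             (∀ c x → f (c M.*ₗ x) N.≈ᴹ c N.*ₗ f x) →
             IsLinear M N f
  isLinear f f-cong f-+ f-* = record
    { +ᴹ-isGroupHomomorphism = record
      { isMonoidHomomorphism = record
        { isMagmaHomomorphism = record
          { isRelHomomorphism = record { cong = f-cong }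
          ; homo              = f-+
          }
        ; ε-homo = f-0
        }
      ; ⁻¹-homo = λ x → inverseˡ-unique (f (M.-ᴹ x)) (f x)
          (N.≈ᴹ-trans (N.≈ᴹ-sym (f-+ (M.-ᴹ x) x))
            (N.≈ᴹ-trans (f-cong (M.-ᴹ‿inverseˡ x)) f-0))
      }
    ; *ₗ-homo = f-*
    }
    where
    open AbelianGroupProperties N.+ᴹ-abelianGroup using (inverseˡ-unique)
    f-0 : f M.0ᴹ N.≈ᴹ N.0ᴹ
    f-0 = N.≈ᴹ-trans (f-cong (M.≈ᴹ-sym (M.*ₗ-zeroˡ M.0ᴹ)))
            (N.≈ᴹ-trans (f-* 0ℚ M.0ᴹ) (N.*ₗ-zeroˡ (f M.0ᴹ)))

-- v_i for every i ∈ ℤ, so that v_{-1} = v_{d+1} = 0.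
v : ∀ {d} → ℤ → Fin (suc d) → ℚ
v i j = if does (i ℤₚ.≟ + toℕ j) then 1ℚ else 0ℚ

vSpace : ℕ → VectorSpace
vSpace d = pointwise (Fin (suc d))

e₊v hv e₋v : ∀ d → Fin (suc d) → Fin (suc d) → ℚ
e₊v d i j = (fromℕ d - fromℕ (toℕ i)) * v (+ toℕ i ℤ.+ + 1) j
hv  d i j = (fromℕ 2 * fromℕ (toℕ i) - fromℕ d) * v (+ toℕ i) j
e₋v d i j = fromℕ (toℕ i) * v (+ toℕ i ℤ.- + 1) j

VE₊ VH VE₋ : ∀ d → (Fin (suc d) → ℚ) → Fin (suc d) → ℚ
VE₊ d = linearCombination (vSpace d) (e₊v d)
VH  d = linearCombination (vSpace d) (hv d)
VE₋ d = linearCombination (vSpace d) (e₋v d)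

linearCombination-lookup : ∀ {A n} (b : Fin n → A → ℚ) c a →
  linearCombination (pointwise A) b c a ≡ sum λ i → c i * b i a
linearCombination-lookup {n = zero}  b c a = refl
linearCombination-lookup {n = suc n} b c a =
  cong (λ x → c zero * b zero a + x) (linearCombination-lookup (b ∘ suc) (c ∘ suc) a)

linearCombination-linear : ∀ {A n} (b : Fin n → A → ℚ) →
  IsLinear (pointwise (Fin n)) (pointwise A) (linearCombination (pointwise A) b)
linearCombination-linear {A} {n} b = isLinear (pointwise (Fin n)) (pointwise A) L
  (λ {f} {g} f≗g a → trans (lk f a) (trans (sum-cong-≗ λ i → cong (_* b i a) (f≗g i)) (sym (lk g a))))
  (λ f g a → trans (lk (λ i → f i + g i) a) (trans (sum-cong-≗ λ i → ℚₚ.*-distribʳ-+ (b i a) (f i) (g i))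
    (trans (∑-distrib-+ (λ i → f i * b i a) (λ i → g i * b i a)) (sym (cong₂ _+_ (lk f a) (lk g a))))))
  (λ c f a → trans (lk (λ i → c * f i) a) (trans (sum-cong-≗ λ i → ℚₚ.*-assoc c (f i) (b i a))
    (trans (sym (*-distribˡ-sum c λ i → f i * b i a)) (cong (c *_) (sym (lk f a))))))
  where
  L = linearCombination (pointwise A) b
  lk = linearCombination-lookup b

-- The coordinate of f at an arbitrary integer index, 0 outside {0, …, d}.
at : ∀ {d} → (Fin (suc d) → ℚ) → ℤ → ℚ
at f k = sum λ i → f i * v k i

v-same : ∀ {d} k (j : Fin (suc d)) → k ≡ + toℕ j → v k j ≡ 1ℚ
v-same k j k≡j = cong (if_then 1ℚ else 0ℚ) (dec-true (k ℤₚ.≟ + toℕ j) k≡j)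

v-diff : ∀ {d} k (j : Fin (suc d)) → k ≢ + toℕ j → v k j ≡ 0ℚ
v-diff k j k≢j = cong (if_then 1ℚ else 0ℚ) (dec-false (k ℤₚ.≟ + toℕ j) k≢j)

coord-term : ∀ x y z a b → (a ≡ 1ℚ × b ≡ 1ℚ × y ≡ z) ⊎ (a ≡ 0ℚ × b ≡ 0ℚ) →
             x * (y * a) ≡ z * (x * b)
coord-term x y _ _ _ (inj₁ (refl , refl , refl)) =
  solve 2 (λ x y → x :* (y :* con 1ℚ) := y :* (x :* con 1ℚ)) refl x y
  where open ℚ-Solver
coord-term x y z _ _ (inj₂ (refl , refl)) =
  solve 3 (λ x y z → x :* (y :* con 0ℚ) := z :* (x :* con 0ℚ)) refl x y z
  where open ℚ-Solver

at-in : ∀ {d} (f : Fin (suc d) → ℚ) j → at f (+ toℕ j) ≡ f j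
at-in f j = trans
  (sum-single (λ i → f i * v (+ toℕ j) i) j λ i i≢j →
    trans (cong (f i *_) (v-diff (+ toℕ j) i λ j≡i →
      i≢j (sym (Finₚ.toℕ-injective (ℤₚ.+-injective j≡i))))) (ℚₚ.*-zeroʳ (f i)))
  (trans (cong (f j *_) (v-same (+ toℕ j) j refl)) (ℚₚ.*-identityʳ (f j)))

at-out : ∀ {d} (f : Fin (suc d) → ℚ) k → (∀ j → k ≢ + toℕ j) → at f k ≡ 0ℚ
at-out f k k≢ = sum-0 _ λ i → trans (cong (f i *_) (v-diff k i (k≢ i))) (ℚₚ.*-zeroʳ (f i))

inRange : ∀ {d} k → (Σ[ j ∈ Fin (suc d) ] k ≡ + toℕ j) ⊎ (∀ (j : Fin (suc d)) → k ≢ + toℕ j)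
inRange k with Finₚ.any? (λ j → k ℤₚ.≟ + toℕ j)
... | yes p = inj₁ p
... | no ¬p = inj₂ λ j k≡j → ¬p (j , k≡j)

private
  i+1-1 : ∀ i → i ℤ.+ + 1 ℤ.- + 1 ≡ i
  i+1-1 = solve 1 (λ i → i :+ con (+ 1) :- con (+ 1) := i) refl
    where open ℤ-Solver
  i-1+1 : ∀ i → i ℤ.- + 1 ℤ.+ + 1 ≡ i
  i-1+1 = solve 1 (λ i → i :- con (+ 1) :+ con (+ 1) := i) refl
    where open ℤ-Solver

fromℤ-pred : ∀ i → fromℤ (i ℤ.- + 1) ≡ fromℤ i - 1ℚ
fromℤ-pred i = fromℤ-+ i -[1+ 0 ]

VE₊-coord : ∀ d f j → VE₊ d f j ≡ (fromℕ d - fromℤ (+ toℕ j ℤ.- + 1)) * at f (+ toℕ j ℤ.- + 1)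
VE₊-coord d f j = trans (linearCombination-lookup (e₊v d) f j)
  (trans (sum-cong-≗ term) (sym (*-distribˡ-sum (fromℕ d - fromℤ k) λ i → f i * v k i)))
  where
  k = + toℕ j ℤ.- + 1
  term : ∀ i → f i * ((fromℕ d - fromℕ (toℕ i)) * v (+ toℕ i ℤ.+ + 1) j)
             ≡ (fromℕ d - fromℤ k) * (f i * v k i)
  term i = case k ℤₚ.≟ + toℕ i of λ where
    (yes k≡i) → coord-term (f i) (fromℕ d - fromℕ (toℕ i)) (fromℕ d - fromℤ k) (v (+ toℕ i ℤ.+ + 1) j) (v k i) (inj₁
          ( v-same (+ toℕ i ℤ.+ + 1) j (trans (cong (ℤ._+ + 1) (sym k≡i)) (i-1+1 (+ toℕ j)))
          , v-same k i k≡i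
          , cong (λ z → fromℕ d - fromℤ z) (sym k≡i) ))
    (no k≢i) → coord-term (f i) (fromℕ d - fromℕ (toℕ i)) (fromℕ d - fromℤ k) (v (+ toℕ i ℤ.+ + 1) j) (v k i) (inj₂
          ( v-diff (+ toℕ i ℤ.+ + 1) j (λ eq → k≢i (trans (cong (ℤ._- + 1) (sym eq)) (i+1-1 (+ toℕ i))))
          , v-diff k i k≢i ))

VE₋-coord : ∀ d f j → VE₋ d f j ≡ fromℤ (+ toℕ j ℤ.+ + 1) * at f (+ toℕ j ℤ.+ + 1)
VE₋-coord d f j = trans (linearCombination-lookup (e₋v d) f j)
  (trans (sum-cong-≗ term) (sym (*-distribˡ-sum (fromℤ k) λ i → f i * v k i)))
  where
  k = + toℕ j ℤ.+ + 1
  term : ∀ i → f i * (fromℕ (toℕ i) * v (+ toℕ i ℤ.- + 1) j) ≡ fromℤ k * (f i * v k i)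
  term i = case k ℤₚ.≟ + toℕ i of λ where
    (yes k≡i) → coord-term (f i) (fromℕ (toℕ i)) (fromℤ k) (v (+ toℕ i ℤ.- + 1) j) (v k i) (inj₁
          ( v-same (+ toℕ i ℤ.- + 1) j (trans (cong (ℤ._- + 1) (sym k≡i)) (i+1-1 (+ toℕ j)))
          , v-same k i k≡i
          , cong fromℤ (sym k≡i) ))
    (no k≢i) → coord-term (f i) (fromℕ (toℕ i)) (fromℤ k) (v (+ toℕ i ℤ.- + 1) j) (v k i) (inj₂
          ( v-diff (+ toℕ i ℤ.- + 1) j (λ eq → k≢i (trans (cong (ℤ._+ + 1) (sym eq)) (i-1+1 (+ toℕ i))))
          , v-diff k i k≢i ))

VH-coord : ∀ d f j → VH d f j ≡ (fromℕ 2 * fromℕ (toℕ j) - fromℕ d) * f j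
VH-coord d f j = trans (linearCombination-lookup (hv d) f j)
  (trans (sum-single (λ i → f i * hv d i j) j λ i i≢j → trans
            (cong (λ z → f i * (w i * z)) (v-diff (+ toℕ i) j λ i≡j →
              i≢j (Finₚ.toℕ-injective (ℤₚ.+-injective i≡j))))
            (solve 2 (λ x y → x :* (y :* con 0ℚ) := con 0ℚ) refl (f i) (w i)))
  (trans (cong (λ z → f j * (w j * z)) (v-same (+ toℕ j) j refl))
         (solve 2 (λ x y → x :* (y :* con 1ℚ) := y :* x) refl (f j) (w j))))
  where
  open ℚ-Solver
  w : Fin (suc d) → ℚ
  w i = fromℕ 2 * fromℕ (toℕ i) - fromℕ d

at-VH : ∀ d f k → at (VH d f) k ≡ (fromℕ 2 * fromℤ k - fromℕ d) * at f k
at-VH d f k with inRange {d} k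
... | inj₁ (j , refl) = trans (at-in (VH d f) j)
        (trans (VH-coord d f j) (cong ((fromℕ 2 * fromℕ (toℕ j) - fromℕ d) *_) (sym (at-in f j))))
... | inj₂ k≢ = trans (at-out (VH d f) k k≢)
        (sym (trans (cong ((fromℕ 2 * fromℤ k - fromℕ d) *_) (at-out f k k≢)) (ℚₚ.*-zeroʳ (fromℕ 2 * fromℤ k - fromℕ d))))

at-VE₊ : ∀ d f k → at (VE₊ d f) k ≡ (fromℕ d - fromℤ (k ℤ.- + 1)) * at f (k ℤ.- + 1)
at-VE₊ d f k with inRange {d} k
... | inj₁ (j , refl) = trans (at-in (VE₊ d f) j) (VE₊-coord d f j)
... | inj₂ k≢ = trans (at-out (VE₊ d f) k k≢) (sym rhs)
  where
  rhs : (fromℕ d - fromℤ (k ℤ.- + 1)) * at f (k ℤ.- + 1) ≡ 0ℚ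
  rhs with inRange {d} (k ℤ.- + 1)
  ... | inj₂ k-1≢ = trans (cong ((fromℕ d - fromℤ (k ℤ.- + 1)) *_) (at-out f (k ℤ.- + 1) k-1≢)) (ℚₚ.*-zeroʳ (fromℕ d - fromℤ (k ℤ.- + 1)))
  ... | inj₁ (i , k-1≡i) with toℕ i ℕₚ.≟ d
  ...   | yes i≡d = trans (cong (_* at f (k ℤ.- + 1))
            (trans (cong (λ z → fromℕ d - fromℤ z) (trans k-1≡i (cong +_ i≡d))) (ℚₚ.+-inverseʳ (fromℕ d))))
            (ℚₚ.*-zeroˡ (at f (k ℤ.- + 1)))
  ...   | no i≢d = contradiction
            (trans (sym (i-1+1 k)) (trans (cong (ℤ._+ + 1) k-1≡i)
              (cong +_ (trans (ℕₚ.+-comm (toℕ i) 1) (sym (Finₚ.toℕ-fromℕ< 1+i<1+d))))))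
            (k≢ (fromℕ< 1+i<1+d))
    where
    1+i<1+d : suc (toℕ i) ℕ.< suc d
    1+i<1+d = s≤s (ℕₚ.≤∧≢⇒< (ℕₚ.≤-pred (Finₚ.toℕ<n i)) i≢d)

at-VE₋ : ∀ d f k → at (VE₋ d f) k ≡ fromℤ (k ℤ.+ + 1) * at f (k ℤ.+ + 1)
at-VE₋ d f k with inRange {d} k
... | inj₁ (j , refl) = trans (at-in (VE₋ d f) j) (VE₋-coord d f j)
... | inj₂ k≢ = trans (at-out (VE₋ d f) k k≢) (sym rhs)
  where
  rhs : fromℤ (k ℤ.+ + 1) * at f (k ℤ.+ + 1) ≡ 0ℚ
  rhs with inRange {d} (k ℤ.+ + 1)
  ... | inj₂ k+1≢ = trans (cong (fromℤ (k ℤ.+ + 1) *_) (at-out f (k ℤ.+ + 1) k+1≢)) (ℚₚ.*-zeroʳ (fromℤ (k ℤ.+ + 1)))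
  ... | inj₁ (zero , k+1≡0) =
          trans (cong (λ z → fromℤ z * at f (k ℤ.+ + 1)) k+1≡0) (ℚₚ.*-zeroˡ (at f (k ℤ.+ + 1)))
  ... | inj₁ (suc i , k+1≡1+i) = contradiction
          (trans (sym (i+1-1 k)) (trans (cong (ℤ._- + 1) k+1≡1+i) (cong +_ (sym (Finₚ.toℕ-inject₁ i)))))
          (k≢ (inject₁ i))

V-[h,e₊] : ∀ d f j → VH d (VE₊ d f) j - VE₊ d (VH d f) j ≡ fromℕ 2 * VE₊ d f j
V-[h,e₊] d f j = begin
  VH d (VE₊ d f) j - VE₊ d (VH d f) j
    ≡⟨ cong₂ _-_ (trans (VH-coord d (VE₊ d f) j) (cong ((fromℕ 2 * J - D) *_) (VE₊-coord d f j)))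
                 (trans (VE₊-coord d (VH d f) j) (cong ((D - fromℤ k) *_) (at-VH d f k))) ⟩
  (fromℕ 2 * J - D) * ((D - fromℤ k) * F) - (D - fromℤ k) * ((fromℕ 2 * fromℤ k - D) * F)
    ≡⟨ cong (λ K → (fromℕ 2 * J - D) * ((D - K) * F) - (D - K) * ((fromℕ 2 * K - D) * F)) K≡ ⟩
  (fromℕ 2 * J - D) * ((D - (J - 1ℚ)) * F) - (D - (J - 1ℚ)) * ((fromℕ 2 * (J - 1ℚ) - D) * F)
    ≡⟨ solve 3 (λ J D F →
         (con (fromℕ 2) :* J :- D) :* ((D :- (J :- con 1ℚ)) :* F)
           :- (D :- (J :- con 1ℚ)) :* ((con (fromℕ 2) :* (J :- con 1ℚ) :- D) :* F)
         := con (fromℕ 2) :* ((D :- (J :- con 1ℚ)) :* F)) refl J D F ⟩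
  fromℕ 2 * ((D - (J - 1ℚ)) * F)
    ≡⟨ cong (λ K → fromℕ 2 * ((D - K) * F)) K≡ ⟨
  fromℕ 2 * ((D - fromℤ k) * F)
    ≡⟨ cong (fromℕ 2 *_) (VE₊-coord d f j) ⟨
  fromℕ 2 * VE₊ d f j ∎
  where
  open ℚ-Solver
  k = + toℕ j ℤ.- + 1
  J = fromℕ (toℕ j)
  D = fromℕ d
  F = at f k
  K≡ : fromℤ k ≡ J - 1ℚ
  K≡ = fromℤ-pred (+ toℕ j)

V-[h,e₋] : ∀ d f j → VH d (VE₋ d f) j - VE₋ d (VH d f) j ≡ (- fromℕ 2) * VE₋ d f j
V-[h,e₋] d f j = begin
  VH d (VE₋ d f) j - VE₋ d (VH d f) j
    ≡⟨ cong₂ _-_ (trans (VH-coord d (VE₋ d f) j) (cong ((fromℕ 2 * J - D) *_) (VE₋-coord d f j)))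
                 (trans (VE₋-coord d (VH d f) j) (cong (fromℤ k *_) (at-VH d f k))) ⟩
  (fromℕ 2 * J - D) * (fromℤ k * F) - fromℤ k * ((fromℕ 2 * fromℤ k - D) * F)
    ≡⟨ cong (λ K → (fromℕ 2 * J - D) * (K * F) - K * ((fromℕ 2 * K - D) * F)) K≡ ⟩
  (fromℕ 2 * J - D) * ((J + 1ℚ) * F) - (J + 1ℚ) * ((fromℕ 2 * (J + 1ℚ) - D) * F)
    ≡⟨ solve 3 (λ J D F →
         (con (fromℕ 2) :* J :- D) :* ((J :+ con 1ℚ) :* F)
           :- (J :+ con 1ℚ) :* ((con (fromℕ 2) :* (J :+ con 1ℚ) :- D) :* F)
         := (:- con (fromℕ 2)) :* ((J :+ con 1ℚ) :* F)) refl J D F ⟩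
  (- fromℕ 2) * ((J + 1ℚ) * F)
    ≡⟨ cong (λ K → (- fromℕ 2) * (K * F)) K≡ ⟨
  (- fromℕ 2) * (fromℤ k * F)
    ≡⟨ cong ((- fromℕ 2) *_) (VE₋-coord d f j) ⟨
  (- fromℕ 2) * VE₋ d f j ∎
  where
  open ℚ-Solver
  k = + toℕ j ℤ.+ + 1
  J = fromℕ (toℕ j)
  D = fromℕ d
  F = at f k
  K≡ : fromℤ k ≡ J + 1ℚ
  K≡ = fromℤ-+ (+ toℕ j) (+ 1)

V-[e₊,e₋] : ∀ d f j → VE₊ d (VE₋ d f) j - VE₋ d (VE₊ d f) j ≡ VH d f j
V-[e₊,e₋] d f j = begin
  VE₊ d (VE₋ d f) j - VE₋ d (VE₊ d f) j
    ≡⟨ cong₂ _-_ (trans (VE₊-coord d (VE₋ d f) j) (cong ((D - fromℤ (j′ ℤ.- + 1)) *_) (at-VE₋ d f (j′ ℤ.- + 1))))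
                 (trans (VE₋-coord d (VE₊ d f) j) (cong (fromℤ (j′ ℤ.+ + 1) *_) (at-VE₊ d f (j′ ℤ.+ + 1)))) ⟩
  (D - fromℤ (j′ ℤ.- + 1)) * (fromℤ (j′ ℤ.- + 1 ℤ.+ + 1) * at f (j′ ℤ.- + 1 ℤ.+ + 1))
    - fromℤ (j′ ℤ.+ + 1) * ((D - fromℤ (j′ ℤ.+ + 1 ℤ.- + 1)) * at f (j′ ℤ.+ + 1 ℤ.- + 1))
    ≡⟨ cong₂ (λ a b → (D - fromℤ (j′ ℤ.- + 1)) * (fromℤ a * at f a)
                        - fromℤ (j′ ℤ.+ + 1) * ((D - fromℤ b) * at f b))
             (i-1+1 j′) (i+1-1 j′) ⟩
  (D - fromℤ (j′ ℤ.- + 1)) * (J * at f j′) - fromℤ (j′ ℤ.+ + 1) * ((D - J) * at f j′)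
    ≡⟨ cong₂ (λ a b → (D - a) * (J * at f j′) - b * ((D - J) * at f j′))
             (fromℤ-pred j′) (fromℤ-+ j′ (+ 1)) ⟩
  (D - (J - 1ℚ)) * (J * at f j′) - (J + 1ℚ) * ((D - J) * at f j′)
    ≡⟨ solve 3 (λ J D F →
         (D :- (J :- con 1ℚ)) :* (J :* F) :- (J :+ con 1ℚ) :* ((D :- J) :* F)
         := (con (fromℕ 2) :* J :- D) :* F) refl J D (at f j′) ⟩
  (fromℕ 2 * J - D) * at f j′
    ≡⟨ cong ((fromℕ 2 * J - D) *_) (at-in f j) ⟩
  (fromℕ 2 * J - D) * f j
    ≡⟨ VH-coord d f j ⟨
  VH d f j ∎
  where
  open ℚ-Solver
  j′ = + toℕ j
  J = fromℕ (toℕ j)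
  D = fromℕ d

V : ℕ → Sl₂Module
V d = record
  { vectorSpace = vSpace d
  ; e₊ = VE₊ d
  ; h  = VH d
  ; e₋ = VE₋ d
  ; e₊-linear = linearCombination-linear (e₊v d)
  ; h-linear  = linearCombination-linear (hv d)
  ; e₋-linear = linearCombination-linear (e₋v d)
  ; [h,e₊]  = V-[h,e₊] d
  ; [h,e₋]  = V-[h,e₋] d
  ; [e₊,e₋] = V-[e₊,e₋] d
  }

δ : ∀ {d} → Exponent d → Exponent d → ℚ → ℚ
δ β α c = if does (β ≟ᴱ α) then c else 0ℚ

δ-yes : ∀ {d} (β α : Exponent d) c → β ≡ α → δ β α c ≡ c
δ-yes β α c eq = cong (if_then c else 0ℚ) (dec-true (β ≟ᴱ α) eq)

δ-no : ∀ {d} (β α : Exponent d) c → β ≢ α → δ β α c ≡ 0ℚ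
δ-no β α c neq = cong (if_then c else 0ℚ) (dec-false (β ≟ᴱ α) neq)

δ-cong : ∀ {d d′} (β α : Exponent d) (β′ α′ : Exponent d′) c →
         (β ≡ α → β′ ≡ α′) → (β′ ≡ α′ → β ≡ α) → δ β α c ≡ δ β′ α′ c
δ-cong β α β′ α′ c to from = case β ≟ᴱ α of λ where
  (yes eq) → trans (δ-yes β α c eq) (sym (δ-yes β′ α′ c (to eq)))
  (no neq) → trans (δ-no β α c neq) (sym (δ-no β′ α′ c (neq ∘ from)))

δ-map : ∀ {d} (g : ℚ → ℚ) → g 0ℚ ≡ 0ℚ → ∀ (β α : Exponent d) c → δ β α (g c) ≡ g (δ β α c)
δ-map g g0 β α c with does (β ≟ᴱ α)
... | true  = refl
... | false = sym g0

coeff-++ : ∀ {d} (p q : Poly d) α → coeff (p ++ q) α ≡ coeff p α + coeff q α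
coeff-++ []            q α = sym (ℚₚ.+-identityˡ (coeff q α))
coeff-++ ((c , β) ∷ p) q α =
  trans (cong (λ x → δ β α c + x) (coeff-++ p q α)) (sym (ℚₚ.+-assoc (δ β α c) (coeff p α) (coeff q α)))

coeff-· : ∀ {d} a (p : Poly d) α → coeff (a · p) α ≡ a * coeff p α
coeff-· a []            α = sym (ℚₚ.*-zeroʳ a)
coeff-· a ((c , β) ∷ p) α =
  trans (cong₂ _+_ (δ-map (a *_) (ℚₚ.*-zeroʳ a) β α c) (coeff-· a p α))
        (sym (ℚₚ.*-distribˡ-+ a (δ β α c) (coeff p α)))

coeff-neg : ∀ {d} (p : Poly d) α → coeff (neg p) α ≡ - coeff p α
coeff-neg []            α = refl
coeff-neg ((c , β) ∷ p) α =
  trans (cong₂ _+_ (δ-map -_ refl β α c) (coeff-neg p α))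
        (sym (ℚₚ.neg-distrib-+ (δ β α c) (coeff p α)))

coeff-∑ : ∀ {d n} (p : Fin n → Poly d) α → coeff (∑ᴾ p) α ≡ sum λ k → coeff (p k) α
coeff-∑ {n = zero}  p α = refl
coeff-∑ {n = suc n} p α =
  trans (coeff-++ (p zero) (∑ᴾ (p ∘ suc)) α) (cong (λ x → coeff (p zero) α + x) (coeff-∑ (p ∘ suc) α))

polySpace : ℕ → VectorSpace
polySpace d = record
  { RawLeftModule raw
  ; isLeftModule = LeftModuleMonomorphism.isLeftModule coeff-mono ℚₚ.+-*-isRing
      (LeftModule.isLeftModule (pointwise (Exponent d)))
  }
  where
  raw : RawLeftModule ℚ 0ℓ 0ℓ
  raw = record
    { Carrierᴹ = Poly d
    ; _≈ᴹ_     = _≈_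
    ; _+ᴹ_     = _++_
    ; _*ₗ_     = _·_
    ; 0ᴹ       = []
    ; -ᴹ_      = neg
    }
  coeff-mono : IsLeftModuleMonomorphism raw (LeftModule.rawLeftModule (pointwise (Exponent d))) coeff
  coeff-mono = record
    { isLeftModuleHomomorphism = record
      { +ᴹ-isGroupHomomorphism = record
        { isMonoidHomomorphism = record
          { isMagmaHomomorphism = record
            { isRelHomomorphism = record { cong = λ p≈q → p≈q }
            ; homo              = coeff-++
            }
          ; ε-homo = λ _ → refl
          }
        ; ⁻¹-homo = coeff-neg
        }
      ; *ₗ-homo = coeff-·
      }
    ; injective = λ p≈q → p≈q
    }

wX wE₊ wH wE₋ : ℕ → ℚ
wX  zero    = 0ℚ
wX  (suc n) = 1ℚ
wE₊ zero    = 0ℚ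
wE₊ (suc n) = 1ℚ - fromℕ n
wH  n       = fromℕ 2 * fromℕ n - 1ℚ
wE₋ n       = fromℕ (suc n)

unit-+ : ∀ {d} (k : Fin d) β → zipWith ℕ._+_ (updateAt (replicate d 0) k (const 1)) β ≡ updateAt β k suc
unit-+ {suc d} zero    (b ∷ β) = cong (suc b ∷_) (Vecₚ.zipWith-identityˡ (λ _ → refl) β)
unit-+ {suc d} (suc k) (b ∷ β) = cong (b ∷_) (unit-+ k β)

suc-pred-at : ∀ {d} (α : Exponent d) k {n} → lookup α k ≡ suc n → updateAt (updateAt α k pred) k suc ≡ α
suc-pred-at α k eq = trans (Vecₚ.updateAt-updateAt k α)
  (Vecₚ.updateAt-id-local k α (trans (cong (ℕ.suc ∘ pred) eq) (sym eq)))

pred-suc-at : ∀ {d} (α : Exponent d) k → updateAt (updateAt α k suc) k pred ≡ α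
pred-suc-at α k = trans (Vecₚ.updateAt-updateAt k α) (Vecₚ.updateAt-id-local k α refl)

X-term : ∀ {d} (k : Fin d) (β α : Exponent d) c n → lookup α k ≡ n →
         δ (updateAt β k suc) α c ≡ wX n * δ β (updateAt α k pred) c
X-term k β α c zero eq = trans
  (δ-no (updateAt β k suc) α c λ β≡α →
    contradiction (trans (sym (Vecₚ.lookup∘updateAt k β)) (trans (cong (λ γ → lookup γ k) β≡α) eq)) λ ())
  (sym (ℚₚ.*-zeroˡ (δ β (updateAt α k pred) c)))
X-term k β α c (suc n) eq = trans
  (δ-cong (updateAt β k suc) α β (updateAt α k pred) c
    (λ β≡α → trans (sym (pred-suc-at β k)) (cong (λ γ → updateAt γ k pred) β≡α))
    (λ β≡α → trans (cong (λ γ → updateAt γ k suc) β≡α) (suc-pred-at α k eq)))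
  (sym (ℚₚ.*-identityˡ (δ β (updateAt α k pred) c)))

coeff-X⊗ : ∀ {d} (k : Fin d) p α →
           coeff (X k ⊗ p) α ≡ wX (lookup α k) * coeff p (updateAt α k pred)
coeff-X⊗ k []            α = sym (ℚₚ.*-zeroʳ (wX (lookup α k)))
coeff-X⊗ k ((c , β) ∷ p) α = trans
  (cong₂ _+_
    (trans (cong₂ (λ γ → δ γ α) (unit-+ k β) (ℚₚ.*-identityˡ c)) (X-term k β α c (lookup α k) refl))
    (coeff-X⊗ k p α))
  (sym (ℚₚ.*-distribˡ-+ (wX (lookup α k)) (δ β (updateAt α k pred) c) (coeff p (updateAt α k pred))))

∂-term : ∀ {d} (k : Fin d) (β α : Exponent d) c n → lookup β k ≡ n →
         δ (updateAt β k pred) α (fromℕ n * c) ≡ fromℕ (suc (lookup α k)) * δ β (updateAt α k suc) c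
∂-term k β α c n eq = case β ≟ᴱ updateAt α k suc of λ where
    (yes β≡) → trans
      (δ-yes (updateAt β k pred) α (fromℕ n * c)
        (trans (cong (λ γ → updateAt γ k pred) β≡) (pred-suc-at α k)))
      (cong₂ (λ m x → fromℕ m * x)
        (trans (sym eq) (trans (cong (λ γ → lookup γ k) β≡) (Vecₚ.lookup∘updateAt k α)))
        (sym (δ-yes β (updateAt α k suc) c β≡)))
    (no β≢) → trans (zero-case n eq β≢)
      (sym (trans (cong (fromℕ (suc (lookup α k)) *_) (δ-no β (updateAt α k suc) c β≢))
                  (ℚₚ.*-zeroʳ (fromℕ (suc (lookup α k))))))
  where
  zero-case : ∀ n → lookup β k ≡ n → β ≢ updateAt α k suc → δ (updateAt β k pred) α (fromℕ n * c) ≡ 0ℚ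
  zero-case zero    eq β≢ = trans
    (δ-map (fromℕ 0 *_) refl (updateAt β k pred) α c) (ℚₚ.*-zeroˡ (δ (updateAt β k pred) α c))
  zero-case (suc m) eq β≢ = δ-no (updateAt β k pred) α (fromℕ (suc m) * c) λ β≡ →
    β≢ (trans (sym (suc-pred-at β k eq)) (cong (λ γ → updateAt γ k suc) β≡))

coeff-∂ : ∀ {d} (k : Fin d) p α →
          coeff (∂ k p) α ≡ fromℕ (suc (lookup α k)) * coeff p (updateAt α k suc)
coeff-∂ k []            α = sym (ℚₚ.*-zeroʳ (fromℕ (suc (lookup α k))))
coeff-∂ k ((c , β) ∷ p) α = trans
  (cong₂ _+_ (∂-term k β α c (lookup β k) refl) (coeff-∂ k p α))
  (sym (ℚₚ.*-distribˡ-+ (fromℕ (suc (lookup α k))) (δ β (updateAt α k suc) c) (coeff p (updateAt α k suc))))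

X⊗X⊗ : ∀ {d} (k : Fin d) p → (X k ⊗ X k) ⊗ p ≡ X k ⊗ (X k ⊗ p)
X⊗X⊗ k []            = refl
X⊗X⊗ {d} k ((c , β) ∷ p) = cong₂ _∷_
  (cong₂ _,_ (ℚₚ.*-assoc 1ℚ 1ℚ c) (Vecₚ.zipWith-assoc ℕₚ.+-assoc u u β))
  (X⊗X⊗ k p)
  where u = updateAt (replicate d 0) k (const 1)

coeff-X∂ : ∀ {d} (k : Fin d) p α → coeff (X k ⊗ ∂ k p) α ≡ fromℕ (lookup α k) * coeff p α
coeff-X∂ k p α = trans (coeff-X⊗ k (∂ k p) α)
  (trans (cong (wX (lookup α k) *_) (coeff-∂ k p (updateAt α k pred))) (lemma (lookup α k) refl))
  where
  α′ = updateAt α k pred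
  lemma : ∀ n → lookup α k ≡ n →
    wX n * (fromℕ (suc (lookup α′ k)) * coeff p (updateAt α′ k suc)) ≡ fromℕ n * coeff p α
  lemma zero    eq = trans (ℚₚ.*-zeroˡ (fromℕ (suc (lookup α′ k)) * coeff p (updateAt α′ k suc)))
                           (sym (ℚₚ.*-zeroˡ (coeff p α)))
  lemma (suc n) eq = trans (ℚₚ.*-identityˡ (fromℕ (suc (lookup α′ k)) * coeff p (updateAt α′ k suc)))
    (cong₂ (λ m γ → fromℕ (suc m) * coeff p γ)
      (trans (Vecₚ.lookup∘updateAt k α) (cong pred eq)) (suc-pred-at α k eq))

coeff-E₊ : ∀ {d} (k : Fin d) p α →
  coeff (neg ((X k ⊗ X k) ⊗ ∂ k p) ++ X k ⊗ p) α ≡ wE₊ (lookup α k) * coeff p (updateAt α k pred)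
coeff-E₊ k p α = begin
  coeff (neg ((X k ⊗ X k) ⊗ ∂ k p) ++ X k ⊗ p) α
    ≡⟨ coeff-++ (neg ((X k ⊗ X k) ⊗ ∂ k p)) (X k ⊗ p) α ⟩
  coeff (neg ((X k ⊗ X k) ⊗ ∂ k p)) α + coeff (X k ⊗ p) α
    ≡⟨ cong₂ _+_
         (trans (coeff-neg ((X k ⊗ X k) ⊗ ∂ k p) α) (cong -_
           (trans (cong (λ q → coeff q α) (X⊗X⊗ k (∂ k p)))
           (trans (coeff-X⊗ k (X k ⊗ ∂ k p) α) (cong (wX (lookup α k) *_)
             (trans (coeff-X∂ k p (updateAt α k pred))
                    (cong (λ m → fromℕ m * P) (Vecₚ.lookup∘updateAt k α))))))))
         (coeff-X⊗ k p α) ⟩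
  - (wX (lookup α k) * (fromℕ (pred (lookup α k)) * P)) + wX (lookup α k) * P
    ≡⟨ lemma (lookup α k) ⟩
  wE₊ (lookup α k) * P ∎
  where
  P = coeff p (updateAt α k pred)
  lemma : ∀ n → - (wX n * (fromℕ (pred n) * P)) + wX n * P ≡ wE₊ n * P
  lemma zero    = solve 1 (λ P → :- (con 0ℚ :* (con 0ℚ :* P)) :+ con 0ℚ :* P := con 0ℚ :* P) refl P
    where open ℚ-Solver
  lemma (suc n) = solve 2 (λ n P → :- (con 1ℚ :* (n :* P)) :+ con 1ℚ :* P := (con 1ℚ :- n) :* P)
                    refl (fromℕ n) P
    where open ℚ-Solver

-- On coefficient functions all three operators take this form.
D : ∀ {d} → (ℕ → ℚ) → (ℕ → ℕ) → (Exponent d → ℚ) → Exponent d → ℚ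
D w s f α = sum λ k → w (lookup α k) * f (updateAt α k s)

polyE₊-D : ∀ {d} (p : Poly d) → coeff (polyE₊ p) ≗ D wE₊ pred (coeff p)
polyE₊-D p α = trans (coeff-∑ (λ k → neg ((X k ⊗ X k) ⊗ ∂ k p) ++ X k ⊗ p) α)
                     (sum-cong-≗ λ k → coeff-E₊ k p α)

polyE₋-D : ∀ {d} (p : Poly d) → coeff (polyE₋ p) ≗ D wE₋ suc (coeff p)
polyE₋-D p α = trans (coeff-∑ (λ k → ∂ k p) α) (sum-cong-≗ λ k → coeff-∂ k p α)

polyH-D : ∀ {d} (p : Poly d) → coeff (polyH p) ≗ D wH id (coeff p)
polyH-D {d} p α = begin
  coeff (fromℕ 2 · ∑ᴾ (λ k → X k ⊗ ∂ k p) ++ neg (fromℕ d · p)) α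
    ≡⟨ coeff-++ (fromℕ 2 · ∑ᴾ (λ k → X k ⊗ ∂ k p)) (neg (fromℕ d · p)) α ⟩
  coeff (fromℕ 2 · ∑ᴾ (λ k → X k ⊗ ∂ k p)) α + coeff (neg (fromℕ d · p)) α
    ≡⟨ cong₂ _+_
         (trans (coeff-· (fromℕ 2) (∑ᴾ (λ k → X k ⊗ ∂ k p)) α) (cong (fromℕ 2 *_)
           (trans (coeff-∑ (λ k → X k ⊗ ∂ k p) α) (sum-cong-≗ λ k → coeff-X∂ k p α))))
         (trans (coeff-neg (fromℕ d · p) α) (cong -_ (coeff-· (fromℕ d) p α))) ⟩
  fromℕ 2 * sum (λ k → fromℕ (lookup α k) * P) + - (fromℕ d * P)
    ≡⟨ lemma (λ k → fromℕ (lookup α k)) ⟩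
  sum (λ k → wH (lookup α k) * P)
    ≡⟨ sum-cong-≗ (λ k → cong (λ γ → wH (lookup α k) * coeff p γ) (sym (Vecₚ.updateAt-id k α))) ⟩
  D wH id (coeff p) α ∎
  where
  P = coeff p α
  lemma : ∀ {n} (t : Fin n → ℚ) →
    fromℕ 2 * sum (λ k → t k * P) + - (fromℕ n * P) ≡ sum (λ k → (fromℕ 2 * t k - 1ℚ) * P)
  lemma {zero}  t = solve 1 (λ P → con (fromℕ 2) :* con 0ℚ :+ :- (con 0ℚ :* P) := con 0ℚ) refl P
    where open ℚ-Solver
  lemma {suc n} t = trans
    (cong (λ N → fromℕ 2 * (t zero * P + S) + - (N * P)) (fromℕ-suc n))
    (trans
      (solve 4 (λ t S N P → con (fromℕ 2) :* (t :* P :+ S) :+ :- ((con 1ℚ :+ N) :* P)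
                 := (con (fromℕ 2) :* t :- con 1ℚ) :* P :+ (con (fromℕ 2) :* S :+ :- (N :* P)))
             refl (t zero) S (fromℕ n) P)
      (cong (λ x → (fromℕ 2 * t zero - 1ℚ) * P + x) (lemma (t ∘ suc))))
    where
    open ℚ-Solver
    S = sum λ k → t (suc k) * P

D-cong : ∀ {d} w s {f g : Exponent d → ℚ} → f ≗ g → D w s f ≗ D w s g
D-cong w s f≗g α = sum-cong-≗ λ k → cong (w (lookup α k) *_) (f≗g (updateAt α k s))

D-+ : ∀ {d} w s (f g : Exponent d → ℚ) α → D w s (λ β → f β + g β) α ≡ D w s f α + D w s g α
D-+ w s f g α = trans
  (sum-cong-≗ λ k → ℚₚ.*-distribˡ-+ (w (lookup α k)) (f (updateAt α k s)) (g (updateAt α k s)))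
  (∑-distrib-+ (λ k → w (lookup α k) * f (updateAt α k s)) (λ k → w (lookup α k) * g (updateAt α k s)))

D-* : ∀ {d} w s c (f : Exponent d → ℚ) α → D w s (λ β → c * f β) α ≡ c * D w s f α
D-* w s c f α = trans
  (sum-cong-≗ λ k → solve 3 (λ w c f → w :* (c :* f) := c :* (w :* f)) refl
                      (w (lookup α k)) c (f (updateAt α k s)))
  (sym (*-distribˡ-sum c λ k → w (lookup α k) * f (updateAt α k s)))
  where open ℚ-Solver

D-bracket : ∀ {d} w s w′ s′ w″ s″ →
  (∀ (g : ℕ → ℚ) n → w n * (w′ (s n) * g (s′ (s n))) - w′ n * (w (s′ n) * g (s (s′ n))) ≡ w″ n * g (s″ n)) →
  ∀ (f : Exponent d → ℚ) α → D w s (D w′ s′ f) α - D w′ s′ (D w s f) α ≡ D w″ s″ f α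
D-bracket w s w′ s′ w″ s″ local f α = begin
  D w s (D w′ s′ f) α - D w′ s′ (D w s f) α
    ≡⟨ cong₂ _-_
         (sum-cong-≗ λ k → *-distribˡ-sum (w (lookup α k)) (λ j → w′ (lookup (updateAt α k s) j) * f (updateAt (updateAt α k s) j s′)))
         (sum-cong-≗ λ k → *-distribˡ-sum (w′ (lookup α k)) (λ j → w (lookup (updateAt α k s′) j) * f (updateAt (updateAt α k s′) j s))) ⟩
  sum (λ k → sum (a k)) - sum (λ k → sum (b k))
    ≡⟨ cong (λ x → sum (λ k → sum (a k)) - x) (∑-comm b) ⟩
  sum (λ k → sum (a k)) - sum (λ k → sum (λ j → b j k))
    ≡⟨ cong (λ x → sum (λ k → sum (a k)) + x) (sym (sum-neg (λ k → sum (λ j → b j k)))) ⟩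
  sum (λ k → sum (a k)) + sum (λ k → - sum (λ j → b j k))
    ≡⟨ sym (∑-distrib-+ (λ k → sum (a k)) (λ k → - sum (λ j → b j k))) ⟩
  sum (λ k → sum (a k) + - sum (λ j → b j k))
    ≡⟨ sum-cong-≗ inner ⟩
  D w″ s″ f α ∎
  where
  a b : _ → _ → ℚ
  a k j = w (lookup α k) * (w′ (lookup (updateAt α k s) j) * f (updateAt (updateAt α k s) j s′))
  b k j = w′ (lookup α k) * (w (lookup (updateAt α k s′) j) * f (updateAt (updateAt α k s′) j s))

  off-diagonal : ∀ k j → j ≢ k → a k j + - b j k ≡ 0ℚ
  off-diagonal k j j≢k = trans
    (cong₂ (λ x y → x + - y)
      (cong₂ (λ m γ → w (lookup α k) * (w′ m * f γ))
        (Vecₚ.lookup∘updateAt′ j k j≢k α) (Vecₚ.updateAt-commutes j k j≢k α))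
      (cong (λ m → w′ (lookup α j) * (w m * f (updateAt (updateAt α j s′) k s)))
        (Vecₚ.lookup∘updateAt′ k j (j≢k ∘ sym) α)))
    (solve 3 (λ x y z → x :* (y :* z) :+ :- (y :* (x :* z)) := con 0ℚ) refl
      (w (lookup α k)) (w′ (lookup α j)) (f (updateAt (updateAt α j s′) k s)))
    where open ℚ-Solver

  inner : ∀ k → sum (a k) + - sum (λ j → b j k) ≡ w″ (lookup α k) * f (updateAt α k s″)
  inner k = begin
    sum (a k) + - sum (λ j → b j k)
      ≡⟨ cong (λ x → sum (a k) + x) (sym (sum-neg (λ j → b j k))) ⟩
    sum (a k) + sum (λ j → - b j k)
      ≡⟨ sym (∑-distrib-+ (a k) (λ j → - b j k)) ⟩
    sum (λ j → a k j + - b j k)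
      ≡⟨ sum-single (λ j → a k j + - b j k) k (off-diagonal k) ⟩
    a k k + - b k k
      ≡⟨ cong₂ (λ x y → x + - y)
           (cong₂ (λ m γ → w (lookup α k) * (w′ m * f γ)) (Vecₚ.lookup∘updateAt k α) (twice s s′))
           (cong₂ (λ m γ → w′ (lookup α k) * (w m * f γ)) (Vecₚ.lookup∘updateAt k α) (twice s′ s)) ⟩
    w n * (w′ (s n) * g (s′ (s n))) - w′ n * (w (s′ n) * g (s (s′ n)))
      ≡⟨ local g n ⟩
    w″ n * g (s″ n)
      ≡⟨ cong (λ γ → w″ n * f γ) (Vecₚ.updateAt-cong-local k α refl) ⟩
    w″ n * f (updateAt α k s″) ∎
    where
    n = lookup α k
    g : ℕ → ℚ
    g m = f (updateAt α k (const m))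
    twice : ∀ s s′ → updateAt (updateAt α k s) k s′ ≡ updateAt α k (const (s′ (s n)))
    twice s s′ = Vecₚ.updateAt-updateAt-local k α refl

local-[h,e₊] : ∀ (g : ℕ → ℚ) n →
  wH n * (wE₊ n * g (pred n)) - wE₊ n * (wH (pred n) * g (pred n)) ≡ (fromℕ 2 * wE₊ n) * g (pred n)
local-[h,e₊] g zero = solve 2 (λ a g → a :* (con 0ℚ :* g) :- con 0ℚ :* (a :* g) := (con (fromℕ 2) :* con 0ℚ) :* g)
  refl (wH 0) (g 0)
  where open ℚ-Solver
local-[h,e₊] g (suc n) = trans
  (cong (λ N → (fromℕ 2 * N - 1ℚ) * ((1ℚ - fromℕ n) * g n) - (1ℚ - fromℕ n) * (wH n * g n)) (fromℕ-suc n))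
  (solve 2 (λ n g → (con (fromℕ 2) :* (con 1ℚ :+ n) :- con 1ℚ) :* ((con 1ℚ :- n) :* g)
                      :- (con 1ℚ :- n) :* ((con (fromℕ 2) :* n :- con 1ℚ) :* g)
                    := (con (fromℕ 2) :* (con 1ℚ :- n)) :* g) refl (fromℕ n) (g n))
  where open ℚ-Solver

local-[h,e₋] : ∀ (g : ℕ → ℚ) n →
  wH n * (wE₋ n * g (suc n)) - wE₋ n * (wH (suc n) * g (suc n)) ≡ ((- fromℕ 2) * wE₋ n) * g (suc n)
local-[h,e₋] g n = trans
  (cong (λ N → wH n * (N * g (suc n)) - N * ((fromℕ 2 * N - 1ℚ) * g (suc n))) (fromℕ-suc n))
  (trans
    (solve 2 (λ n g → (con (fromℕ 2) :* n :- con 1ℚ) :* ((con 1ℚ :+ n) :* g)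
                        :- (con 1ℚ :+ n) :* ((con (fromℕ 2) :* (con 1ℚ :+ n) :- con 1ℚ) :* g)
                      := ((:- con (fromℕ 2)) :* (con 1ℚ :+ n)) :* g) refl (fromℕ n) (g (suc n)))
    (cong (λ N → ((- fromℕ 2) * N) * g (suc n)) (sym (fromℕ-suc n))))
  where open ℚ-Solver

local-[e₊,e₋] : ∀ (g : ℕ → ℚ) n →
  wE₊ n * (wE₋ (pred n) * g (suc (pred n))) - wE₋ n * (wE₊ (suc n) * g n) ≡ wH n * g n
local-[e₊,e₋] g zero =
  solve 2 (λ g x → con 0ℚ :* (con 1ℚ :* x) :- con 1ℚ :* ((con 1ℚ :- con 0ℚ) :* g)
                   := (con (fromℕ 2) :* con 0ℚ :- con 1ℚ) :* g) refl (g 0) (g 1)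
  where open ℚ-Solver
local-[e₊,e₋] g (suc n) = trans
  (cong₂ (λ N M → (1ℚ - fromℕ n) * (N * g (suc n)) - M * ((1ℚ - N) * g (suc n)))
    (fromℕ-suc n) (trans (fromℕ-suc (suc n)) (cong (1ℚ +′_) (fromℕ-suc n))))
  (trans
    (solve 2 (λ n g → (con 1ℚ :- n) :* ((con 1ℚ :+ n) :* g)
                        :- (con 1ℚ :+ (con 1ℚ :+ n)) :* ((con 1ℚ :- (con 1ℚ :+ n)) :* g)
                      := (con (fromℕ 2) :* (con 1ℚ :+ n) :- con 1ℚ) :* g) refl (fromℕ n) (g (suc n)))
    (cong (λ N → (fromℕ 2 * N - 1ℚ) * g (suc n)) (sym (fromℕ-suc n))))
  where
  open ℚ-Solver
  _+′_ = _+_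

polyLinear : ∀ {d} w s (F : Poly d → Poly d) → (∀ p → coeff (F p) ≗ D w s (coeff p)) →
             IsLinear (polySpace d) (polySpace d) F
polyLinear {d} w s F F-D = isLinear (polySpace d) (polySpace d) F
  (λ {p} {q} p≈q α → trans (F-D p α) (trans (D-cong w s p≈q α) (sym (F-D q α))))
  (λ p q α → trans (F-D (p ++ q) α) (trans (D-cong w s (coeff-++ p q) α)
    (trans (D-+ w s (coeff p) (coeff q) α)
    (trans (sym (cong₂ _+_ (F-D p α) (F-D q α))) (sym (coeff-++ (F p) (F q) α))))))
  (λ c p α → trans (F-D (c · p) α) (trans (D-cong w s (coeff-· c p) α)
    (trans (D-* w s c (coeff p) α)
    (trans (sym (cong (c *_) (F-D p α))) (sym (coeff-· c (F p) α))))))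

polyBracket : ∀ {d} w s w′ s′ w″ s″ (F G K : Poly d → Poly d) →
  (∀ p → coeff (F p) ≗ D w s (coeff p)) → (∀ p → coeff (G p) ≗ D w′ s′ (coeff p)) →
  (∀ p → coeff (K p) ≗ D w″ s″ (coeff p)) →
  (∀ (g : ℕ → ℚ) n → w n * (w′ (s n) * g (s′ (s n))) - w′ n * (w (s′ n) * g (s (s′ n))) ≡ w″ n * g (s″ n)) →
  ∀ p → F (G p) ++ neg (G (F p)) ≈ K p
polyBracket w s w′ s′ w″ s″ F G K F-D G-D K-D local p α = trans
  (coeff-++ (F (G p)) (neg (G (F p))) α)
  (trans (cong₂ _+_
      (trans (F-D (G p) α) (D-cong w s (G-D p) α))
      (trans (coeff-neg (G (F p)) α) (cong -_ (trans (G-D (F p) α) (D-cong w′ s′ (F-D p) α)))))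
  (trans (D-bracket w s w′ s′ w″ s″ local (coeff p) α) (sym (K-D p α))))

scaled-D : ∀ {d} c w s (F : Poly d → Poly d) → (∀ p → coeff (F p) ≗ D w s (coeff p)) →
           ∀ p → coeff (c · F p) ≗ D (λ n → c * w n) s (coeff p)
scaled-D c w s F F-D p α = trans (coeff-· c (F p) α) (trans (cong (c *_) (F-D p α))
  (trans (*-distribˡ-sum c λ k → w (lookup α k) * coeff p (updateAt α k s))
         (sum-cong-≗ λ k → sym (ℚₚ.*-assoc c (w (lookup α k)) (coeff p (updateAt α k s))))))

polyModule : ℕ → Sl₂Module
polyModule d = record
  { vectorSpace = polySpace d
  ; e₊ = polyE₊
  ; h  = polyH
  ; e₋ = polyE₋
  ; e₊-linear = polyLinear wE₊ pred polyE₊ polyE₊-D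
  ; h-linear  = polyLinear wH id polyH polyH-D
  ; e₋-linear = polyLinear wE₋ suc polyE₋ polyE₋-D
  ; [h,e₊]  = polyBracket wH id wE₊ pred (λ n → fromℕ 2 * wE₊ n) pred polyH polyE₊ (λ p → fromℕ 2 · polyE₊ p)
                polyH-D polyE₊-D (scaled-D (fromℕ 2) wE₊ pred polyE₊ polyE₊-D) local-[h,e₊]
  ; [h,e₋]  = polyBracket wH id wE₋ suc (λ n → (- fromℕ 2) * wE₋ n) suc polyH polyE₋ (λ p → (- fromℕ 2) · polyE₋ p)
                polyH-D polyE₋-D (scaled-D (- fromℕ 2) wE₋ suc polyE₋ polyE₋-D) local-[h,e₋]
  ; [e₊,e₋] = polyBracket wE₊ pred wE₋ suc wH id polyE₊ polyE₋ polyH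
                polyE₊-D polyE₋-D polyH-D local-[e₊,e₋]
  }

module _ (M : Sl₂Module) where
  open Sl₂Module M

  record IsSubmodule (P : Carrierᴹ → Set) : Set where
    field
      +-closed   : ∀ {x y} → P x → P y → P (x +ᴹ y)
      *-closed   : ∀ c {x} → P x → P (c *ₗ x)
      0-closed   : P 0ᴹ
      neg-closed : ∀ {x} → P x → P (-ᴹ x)
      e₊-closed  : ∀ {x} → P x → P (e₊ x)
      h-closed   : ∀ {x} → P x → P (h x)
      e₋-closed  : ∀ {x} → P x → P (e₋ x)

  submodule : {P : Carrierᴹ → Set} → IsSubmodule P → Sl₂Module
  submodule {P} isSub = record
    { vectorSpace = subspace
    ; e₊ = λ (x , px) → e₊ x , e₊-closed px
    ; h  = λ (x , px) → h x , h-closed px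
    ; e₋ = λ (x , px) → e₋ x , e₋-closed px
    ; e₊-linear = let open IsLeftModuleHomomorphism e₊-linear in
        isLinear subspace subspace _ (λ p → ⟦⟧-cong p) (λ (x , _) (y , _) → +ᴹ-homo x y) (λ c (x , _) → *ₗ-homo c x)
    ; h-linear = let open IsLeftModuleHomomorphism h-linear in
        isLinear subspace subspace _ (λ p → ⟦⟧-cong p) (λ (x , _) (y , _) → +ᴹ-homo x y) (λ c (x , _) → *ₗ-homo c x)
    ; e₋-linear = let open IsLeftModuleHomomorphism e₋-linear in
        isLinear subspace subspace _ (λ p → ⟦⟧-cong p) (λ (x , _) (y , _) → +ᴹ-homo x y) (λ c (x , _) → *ₗ-homo c x)
    ; [h,e₊]  = λ (x , _) → [h,e₊] x
    ; [h,e₋]  = λ (x , _) → [h,e₋] x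
    ; [e₊,e₋] = λ (x , _) → [e₊,e₋] x
    }
    where
    open IsSubmodule isSub
    raw : RawLeftModule ℚ 0ℓ 0ℓ
    raw = record
      { Carrierᴹ = Σ Carrierᴹ P
      ; _≈ᴹ_     = λ (x , _) (y , _) → x ≈ᴹ y
      ; _+ᴹ_     = λ (x , px) (y , py) → x +ᴹ y , +-closed px py
      ; _*ₗ_     = λ c (x , px) → c *ₗ x , *-closed c px
      ; 0ᴹ       = 0ᴹ , 0-closed
      ; -ᴹ_      = λ (x , px) → -ᴹ x , neg-closed px
      }
    proj₁-mono : IsLeftModuleMonomorphism raw rawLeftModule proj₁
    proj₁-mono = record
      { isLeftModuleHomomorphism = record
        { +ᴹ-isGroupHomomorphism = record
          { isMonoidHomomorphism = record
            { isMagmaHomomorphism = record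
              { isRelHomomorphism = record { cong = λ p → p }
              ; homo              = λ _ _ → ≈ᴹ-refl
              }
            ; ε-homo = ≈ᴹ-refl
            }
          ; ⁻¹-homo = λ _ → ≈ᴹ-refl
          }
        ; *ₗ-homo = λ _ _ → ≈ᴹ-refl
        }
      ; injective = λ p → p
      }
    subspace : VectorSpace
    subspace = record
      { RawLeftModule raw
      ; isLeftModule = LeftModuleMonomorphism.isLeftModule proj₁-mono ℚₚ.+-*-isRing isLeftModule }

IsSymmetricMultiaffine : ∀ {d} → Poly d → Set
IsSymmetricMultiaffine p = IsSymmetric p × (∀ k → (DegreeIn k ≤ 1) p)

pull : ∀ {d} → Permutation′ d → Exponent d → Exponent d
pull σ α = tabulate λ k → lookup α (σ ⟨$⟩ʳ k)

lookup-ext : ∀ {d} {α β : Exponent d} → (∀ k → lookup α k ≡ lookup β k) → α ≡ β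
lookup-ext {α = α} {β} eq =
  trans (sym (Vecₚ.tabulate∘lookup α)) (trans (Vecₚ.tabulate-cong eq) (Vecₚ.tabulate∘lookup β))

lookup-pull : ∀ {d} σ (α : Exponent d) k → lookup (pull σ α) k ≡ lookup α (σ ⟨$⟩ʳ k)
lookup-pull σ α k = Vecₚ.lookup∘tabulate (λ k → lookup α (σ ⟨$⟩ʳ k)) k

coeff-rename : ∀ {d} σ (p : Poly d) α → coeff (rename σ p) α ≡ coeff p (pull σ α)
coeff-rename σ []            α = refl
coeff-rename σ ((c , β) ∷ p) α = cong₂ _+_
  (δ-cong β′ α β (pull σ α) c
    (λ β′≡α → lookup-ext λ k → begin
      lookup β k                     ≡⟨ cong (lookup β) (inverseˡ σ) ⟨
      lookup β (σ ⟨$⟩ˡ (σ ⟨$⟩ʳ k))  ≡⟨ Vecₚ.lookup∘tabulate (λ j → lookup β (σ ⟨$⟩ˡ j)) (σ ⟨$⟩ʳ k) ⟨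
      lookup β′ (σ ⟨$⟩ʳ k)          ≡⟨ cong (λ γ → lookup γ (σ ⟨$⟩ʳ k)) β′≡α ⟩
      lookup α (σ ⟨$⟩ʳ k)           ≡⟨ lookup-pull σ α k ⟨
      lookup (pull σ α) k            ∎)
    (λ β≡ → lookup-ext λ j → begin
      lookup β′ j                    ≡⟨ Vecₚ.lookup∘tabulate (λ j → lookup β (σ ⟨$⟩ˡ j)) j ⟩
      lookup β (σ ⟨$⟩ˡ j)           ≡⟨ cong (λ γ → lookup γ (σ ⟨$⟩ˡ j)) β≡ ⟩
      lookup (pull σ α) (σ ⟨$⟩ˡ j)  ≡⟨ lookup-pull σ α (σ ⟨$⟩ˡ j) ⟩
      lookup α (σ ⟨$⟩ʳ (σ ⟨$⟩ˡ j))  ≡⟨ cong (lookup α) (inverseʳ σ) ⟩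
      lookup α j                     ∎))
  (coeff-rename σ p α)
  where β′ = tabulate λ j → lookup β (σ ⟨$⟩ˡ j)

record Admissible {d} (f : Exponent d → ℚ) : Set where
  field
    invariant : ∀ σ α → f (pull σ α) ≡ f α
    vanishing : ∀ α k → 2 ℕ.≤ lookup α k → f α ≡ 0ℚ

open Admissible

admissible : ∀ {d} (p : Poly d) → IsSymmetricMultiaffine p → Admissible (coeff p)
admissible p (symm , deg) .invariant σ α = trans (sym (coeff-rename σ p α)) (symm σ α)
admissible p (symm , deg) .vanishing α k 2≤αₖ = case coeff p α ℚₚ.≟ 0ℚ of λ where
  (yes eq) → eq
  (no neq) → contradiction (ℕₚ.≤-trans 2≤αₖ (deg k α neq)) λ { (s≤s ()) }

fromAdmissible : ∀ {d} (p : Poly d) {f} → coeff p ≗ f → Admissible f → IsSymmetricMultiaffine p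
fromAdmissible p p≗f adm =
  (λ σ α → trans (coeff-rename σ p α)
             (trans (p≗f (pull σ α)) (trans (adm .invariant σ α) (sym (p≗f α))))) ,
  (λ k α pα≢0 → case lookup α k ℕₚ.≤? 1 of λ where
     (yes αₖ≤1) → αₖ≤1
     (no αₖ≰1)  → contradiction (trans (p≗f α) (adm .vanishing α k (ℕₚ.≰⇒> αₖ≰1))) pα≢0)

D-admissible : ∀ {d} w s → (∀ n → 2 ℕ.≤ n → 2 ℕ.≤ s n ⊎ w n ≡ 0ℚ) →
               (f : Exponent d → ℚ) → Admissible f → Admissible (D w s f)
D-admissible w s edge f adm .invariant σ α = begin
  sum (λ k → w (lookup (pull σ α) k) * f (updateAt (pull σ α) k s))
    ≡⟨ sum-cong-≗ (λ k → cong₂ (λ m x → w m * x) (lookup-pull σ α k)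
         (trans (cong f (update-pull k)) (adm .invariant σ (updateAt α (σ ⟨$⟩ʳ k) s)))) ⟩
  sum (λ k → w (lookup α (σ ⟨$⟩ʳ k)) * f (updateAt α (σ ⟨$⟩ʳ k) s))
    ≡⟨ sum-permute (λ k → w (lookup α k) * f (updateAt α k s)) σ ⟨
  D w s f α ∎
  where
  update-pull : ∀ k → updateAt (pull σ α) k s ≡ pull σ (updateAt α (σ ⟨$⟩ʳ k) s)
  update-pull k = lookup-ext λ j → trans (case j Finₚ.≟ k of λ where
    (yes refl) → trans (Vecₚ.lookup∘updateAt k (pull σ α))
                   (trans (cong s (lookup-pull σ α k)) (sym (Vecₚ.lookup∘updateAt (σ ⟨$⟩ʳ k) α)))
    (no j≢k)   → trans (Vecₚ.lookup∘updateAt′ j k j≢k (pull σ α))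
                   (trans (lookup-pull σ α j)
                     (sym (Vecₚ.lookup∘updateAt′ (σ ⟨$⟩ʳ j) (σ ⟨$⟩ʳ k)
                       (λ eq → j≢k (trans (sym (inverseˡ σ)) (trans (cong (σ ⟨$⟩ˡ_) eq) (inverseˡ σ)))) α))))
    (sym (lookup-pull σ (updateAt α (σ ⟨$⟩ʳ k) s) j))
D-admissible w s edge f adm .vanishing α k 2≤αₖ = sum-0 _ term
  where
  zeroʳ : ∀ j → f (updateAt α j s) ≡ 0ℚ → w (lookup α j) * f (updateAt α j s) ≡ 0ℚ
  zeroʳ j eq = trans (cong (w (lookup α j) *_) eq) (ℚₚ.*-zeroʳ (w (lookup α j)))

  diagonal : 2 ℕ.≤ s (lookup α k) ⊎ w (lookup α k) ≡ 0ℚ → w (lookup α k) * f (updateAt α k s) ≡ 0ℚ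
  diagonal (inj₁ 2≤s) = zeroʳ k (adm .vanishing (updateAt α k s) k
                          (subst (2 ℕ.≤_) (sym (Vecₚ.lookup∘updateAt k α)) 2≤s))
  diagonal (inj₂ w≡0) = trans (cong (_* f (updateAt α k s)) w≡0) (ℚₚ.*-zeroˡ (f (updateAt α k s)))

  term : ∀ j → w (lookup α j) * f (updateAt α j s) ≡ 0ℚ
  term j = case k Finₚ.≟ j of λ where
    (no k≢j)   → zeroʳ j (adm .vanishing (updateAt α j s) k
                   (subst (2 ℕ.≤_) (sym (Vecₚ.lookup∘updateAt′ k j k≢j α)) 2≤αₖ))
    (yes refl) → diagonal (edge (lookup α k) 2≤αₖ)

symmetricMultiaffine-isSubmodule : ∀ d → IsSubmodule (polyModule d) IsSymmetricMultiaffine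
symmetricMultiaffine-isSubmodule d = record
  { +-closed   = λ {p} {q} ap aq → fromAdmissible (p ++ q) (coeff-++ p q) record
    { invariant = λ σ α → cong₂ _+_ (admissible p ap .invariant σ α) (admissible q aq .invariant σ α)
    ; vanishing = λ α k 2≤ → cong₂ _+_ (admissible p ap .vanishing α k 2≤) (admissible q aq .vanishing α k 2≤)
    }
  ; *-closed   = λ c {p} ap → fromAdmissible (c · p) (coeff-· c p) record
    { invariant = λ σ α → cong (c *_) (admissible p ap .invariant σ α)
    ; vanishing = λ α k 2≤ → trans (cong (c *_) (admissible p ap .vanishing α k 2≤)) (ℚₚ.*-zeroʳ c)
    }
  ; 0-closed   = fromAdmissible [] (λ _ → refl) record
    { invariant = λ _ _ → refl ; vanishing = λ _ _ _ → refl }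
  ; neg-closed = λ {p} ap → fromAdmissible (neg p) (coeff-neg p) record
    { invariant = λ σ α → cong -_ (admissible p ap .invariant σ α)
    ; vanishing = λ α k 2≤ → cong -_ (admissible p ap .vanishing α k 2≤)
    }
  ; e₊-closed  = λ {p} ap → fromAdmissible (polyE₊ p) (polyE₊-D p) (D-admissible wE₊ pred edge (coeff p) (admissible p ap))
  ; h-closed   = λ {p} ap → fromAdmissible (polyH p) (polyH-D p) (D-admissible wH id (λ _ → inj₁) (coeff p) (admissible p ap))
  ; e₋-closed  = λ {p} ap → fromAdmissible (polyE₋ p) (polyE₋-D p) (D-admissible wE₋ suc (λ _ 2≤ → inj₁ (ℕₚ.m≤n⇒m≤1+n 2≤)) (coeff p) (admissible p ap))
  }
  where
  edge : ∀ n → 2 ℕ.≤ n → 2 ℕ.≤ pred n ⊎ wE₊ n ≡ 0ℚ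
  edge (suc (suc zero))    _ = inj₂ refl
  edge (suc (suc (suc n))) _ = inj₁ (s≤s (s≤s z≤n))
  edge (suc zero) (s≤s ())

Λ : ℕ → Sl₂Module
Λ d = submodule (polyModule d) (symmetricMultiaffine-isSubmodule d)

module ℚ∏ = CommutativeMonoidSum ℚₚ.*-1-commutativeMonoid
module ℕ∑ = CommutativeMonoidSum ℕₚ.+-0-commutativeMonoid

≤1? : ℕ → ℚ
≤1? 0 = 1ℚ
≤1? 1 = 1ℚ
≤1? (suc (suc n)) = 0ℚ

monomials : ∀ {d} → List (Subset d) → Poly d
monomials = List.map λ S → 1ℚ , indicator S

degree : ∀ {d} → Exponent d → ℕ
degree α = ℕ∑.sum (lookup α)

degree-indicator : ∀ {d} (S : Subset d) → degree (indicator S) ≡ ∣ S ∣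
degree-indicator []            = refl
degree-indicator (true  ∷ S) = cong suc (degree-indicator S)
degree-indicator (false ∷ S) = degree-indicator S

coeff-filter : ∀ {d} i (L : List (Subset d)) α →
  coeff (monomials (filter (λ S → ∣ S ∣ ℕₚ.≟ i) L)) α
    ≡ (if does (degree α ℕₚ.≟ i) then coeff (monomials L) α else 0ℚ)
coeff-filter i []      α with does (degree α ℕₚ.≟ i)
... | true  = refl
... | false = refl
coeff-filter i (S ∷ L) α = case ∣ S ∣ ℕₚ.≟ i of λ where
    (yes ∣S∣≡i) → trans
      (cong (λ L → coeff (monomials L) α) (Listₚ.filter-accept (λ S → ∣ S ∣ ℕₚ.≟ i) {x = S} {xs = L} ∣S∣≡i))
      (trans (cong (λ x → δ (indicator S) α 1ℚ + x) (coeff-filter i L α))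
        (case degree α ℕₚ.≟ i of λ where
          (yes p) → trans (cong (λ x → δ (indicator S) α 1ℚ + x) (if-yes p)) (sym (if-yes p))
          (no ¬p) → trans (cong₂ _+_
            (δ-no (indicator S) α 1ℚ λ S≡α →
              ¬p (trans (cong degree (sym S≡α)) (trans (degree-indicator S) ∣S∣≡i)))
            (if-no ¬p)) (sym (if-no ¬p))))
    (no ∣S∣≢i) → trans
      (cong (λ L → coeff (monomials L) α) (Listₚ.filter-reject (λ S → ∣ S ∣ ℕₚ.≟ i) {x = S} {xs = L} ∣S∣≢i))
      (trans (coeff-filter i L α)
        (case degree α ℕₚ.≟ i of λ where
          (yes p) → trans (if-yes p) (trans
            (sym (trans (cong (_+ᵠ coeff (monomials L) α) (δ-no (indicator S) α 1ℚ λ S≡α →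
              ∣S∣≢i (trans (sym (degree-indicator S)) (trans (cong degree S≡α) p))))
              (ℚₚ.+-identityˡ (coeff (monomials L) α))))
            (sym (if-yes p)))
          (no ¬p) → trans (if-no ¬p) (sym (if-no ¬p))))
  where
  _+ᵠ_ = _+_
  if-yes : ∀ {x} → degree α ≡ i → (if does (degree α ℕₚ.≟ i) then x else 0ℚ) ≡ x
  if-yes {x} p = cong (if_then x else 0ℚ) (dec-true (degree α ℕₚ.≟ i) p)
  if-no : ∀ {x} → degree α ≢ i → (if does (degree α ℕₚ.≟ i) then x else 0ℚ) ≡ 0ℚ
  if-no {x} ¬p = cong (if_then x else 0ℚ) (dec-false (degree α ℕₚ.≟ i) ¬p)

coeff-cons : ∀ {d} s (L : List (Subset d)) a α →
  coeff (monomials (List.map (s ∷_) L)) (a ∷ α)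
    ≡ (if does ((if s then 1 else 0) ℕₚ.≟ a) then coeff (monomials L) α else 0ℚ)
coeff-cons s []      a α with does ((if s then 1 else 0) ℕₚ.≟ a)
... | true  = refl
... | false = refl
coeff-cons s (S ∷ L) a α = trans (cong (λ x → δ (indicator (s ∷ S)) (a ∷ α) 1ℚ + x) (coeff-cons s L a α))
  (case (if s then 1 else 0) ℕₚ.≟ a of λ where
    (yes p) → trans (cong₂ _+_
        (δ-cong (indicator (s ∷ S)) (a ∷ α) (indicator S) α 1ℚ Vecₚ.∷-injectiveʳ (cong₂ _∷_ p))
        (if-yes p)) (sym (if-yes p))
    (no ¬p) → trans (cong₂ _+_
        (δ-no (indicator (s ∷ S)) (a ∷ α) 1ℚ (¬p ∘ Vecₚ.∷-injectiveˡ))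
        (if-no ¬p)) (sym (if-no ¬p)))
  where
  if-yes : ∀ {x} → (if s then 1 else 0) ≡ a → (if does ((if s then 1 else 0) ℕₚ.≟ a) then x else 0ℚ) ≡ x
  if-yes {x} p = cong (if_then x else 0ℚ) (dec-true ((if s then 1 else 0) ℕₚ.≟ a) p)
  if-no : ∀ {x} → (if s then 1 else 0) ≢ a → (if does ((if s then 1 else 0) ℕₚ.≟ a) then x else 0ℚ) ≡ 0ℚ
  if-no {x} ¬p = cong (if_then x else 0ℚ) (dec-false ((if s then 1 else 0) ℕₚ.≟ a) ¬p)

coeff-subsets : ∀ d (α : Exponent d) → coeff (monomials (subsets d)) α ≡ ℚ∏.sum (λ k → ≤1? (lookup α k))
coeff-subsets zero    []      = refl
coeff-subsets (suc d) (a ∷ α) = begin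
  coeff (monomials (List.map (inside ∷_) (subsets d) ++ List.map (outside ∷_) (subsets d))) (a ∷ α)
    ≡⟨ cong (λ p → coeff p (a ∷ α)) (Listₚ.map-++ (λ S → 1ℚ , indicator S)
         (List.map (inside ∷_) (subsets d)) (List.map (outside ∷_) (subsets d))) ⟩
  coeff (monomials (List.map (inside ∷_) (subsets d)) ++ monomials (List.map (outside ∷_) (subsets d))) (a ∷ α)
    ≡⟨ coeff-++ (monomials (List.map (inside ∷_) (subsets d))) (monomials (List.map (outside ∷_) (subsets d))) (a ∷ α) ⟩
  coeff (monomials (List.map (inside ∷_) (subsets d))) (a ∷ α)
    + coeff (monomials (List.map (outside ∷_) (subsets d))) (a ∷ α)
    ≡⟨ cong₂ _+_ (coeff-cons inside (subsets d) a α) (coeff-cons outside (subsets d) a α) ⟩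
  (if does (1 ℕₚ.≟ a) then C else 0ℚ) + (if does (0 ℕₚ.≟ a) then C else 0ℚ)
    ≡⟨ lemma a ⟩
  ≤1? a * C
    ≡⟨ cong (≤1? a *_) (coeff-subsets d α) ⟩
  ≤1? a * ℚ∏.sum (λ k → ≤1? (lookup α k)) ∎
  where
  C = coeff (monomials (subsets d)) α
  lemma : ∀ a → (if does (1 ℕₚ.≟ a) then C else 0ℚ) + (if does (0 ℕₚ.≟ a) then C else 0ℚ) ≡ ≤1? a * C
  lemma 0 = trans (ℚₚ.+-identityˡ C) (sym (ℚₚ.*-identityˡ C))
  lemma 1 = trans (ℚₚ.+-identityʳ C) (sym (ℚₚ.*-identityˡ C))
  lemma (suc (suc a)) = sym (ℚₚ.*-zeroˡ C)

∏-zero : ∀ {n} (t : Fin n → ℚ) k → t k ≡ 0ℚ → ℚ∏.sum t ≡ 0ℚ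
∏-zero t zero    eq = trans (cong (_* ℚ∏.sum (t ∘ suc)) eq) (ℚₚ.*-zeroˡ (ℚ∏.sum (t ∘ suc)))
∏-zero t (suc k) eq = trans (cong (t zero *_) (∏-zero (t ∘ suc) k eq)) (ℚₚ.*-zeroʳ (t zero))

elementary∈Λ : ∀ d i → IsSymmetricMultiaffine (elementary d i)
elementary∈Λ d i = fromAdmissible (elementary d i)
  (λ α → trans (coeff-filter i (subsets d) α)
    (cong (λ x → if does (degree α ℕₚ.≟ i) then x else 0ℚ) (coeff-subsets d α)))
  record
  { invariant = λ σ α → cong₂ (λ n x → if does (n ℕₚ.≟ i) then x else 0ℚ)
      (trans (ℕ∑.sum-cong-≗ (lookup-pull σ α)) (sym (ℕ∑.sum-permute (lookup α) σ)))
      (trans (ℚ∏.sum-cong-≗ (λ k → cong ≤1? (lookup-pull σ α k)))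
             (sym (ℚ∏.sum-permute (λ k → ≤1? (lookup α k)) σ)))
  ; vanishing = λ α k 2≤αₖ → trans
      (cong (λ x → if does (degree α ℕₚ.≟ i) then x else 0ℚ)
        (∏-zero (λ k → ≤1? (lookup α k)) k (≤1?-large (lookup α k) 2≤αₖ)))
      (if-same (does (degree α ℕₚ.≟ i)))
  }
  where
  ≤1?-large : ∀ n → 2 ℕ.≤ n → ≤1? n ≡ 0ℚ
  ≤1?-large (suc (suc n)) _ = refl
  ≤1?-large (suc zero) (s≤s ())
  if-same : ∀ b → (if b then 0ℚ else 0ℚ) ≡ 0ℚ
  if-same true  = refl
  if-same false = refl

P′-nonZero : ∀ d i → i ℕ.≤ d → NonZero (d P′ i)
P′-nonZero d zero    _   = _
P′-nonZero d (suc i) i<d = ℕₚ.m*n≢0 (d ℕ.∸ i) (d P′ i)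
  where instance
    _ = ℕ.>-nonZero (ℕₚ.m<n⇒0<n∸m i<d)
    _ = P′-nonZero d i (ℕₚ.<⇒≤ i<d)

e : ∀ d → ℕ → Sl₂Module.Carrierᴹ (Λ d)
e d i = elementary d i , elementary∈Λ d i

-- d P′ i = (d ∸ (i ∸ 1)) * ⋯ * (d ∸ 1) * d
w : ∀ d → Fin (suc d) → Sl₂Module.Carrierᴹ (Λ d)
w d zero    = e d 0
w d (suc j) = ((+ (i !)) / (d P′ i)) *ₗ e d i
  where
  open Sl₂Module (Λ d) using (_*ₗ_)
  i = suc (toℕ j)
  instance _ = P′-nonZero d i (Finₚ.toℕ<n j)

-- An element of Λ_d^(1) is determined by its coefficients at the monomials
-- x₁ ⋯ xᵢ, 0 ≤ i ≤ d: permuting the variables brings every squarefree monomial to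
-- this form. In these coordinates wᵢ is a positive multiple cᵢ of the i-th unit
-- vector, so the wᵢ form a basis, and e₊, h, e₋ act on the i-th coordinate through
-- i, 2i − d, d − i, because a squarefree monomial of degree i has i exponents equal
-- to 1 and d − i equal to 0. Both ladder relations then reduce to the single
-- identity (d − i) cᵢ₊₁ = (i + 1) cᵢ.
module Submission where

open import Defs
open import Algebra.Module.Morphism.Structures using (IsLeftModuleHomomorphism)
open import Data.Bool.Base using (if_then_else_)
open import Data.Fin.Base using (Fin; zero; suc; toℕ; fromℕ<; inject₁)
open import Data.Fin.Permutation using (lift₀; swap)
import Data.Fin.Permutation as Perm
import Data.Fin.Base as Fin
import Data.Fin.Properties as Finₚ
open import Data.Fin.Relation.Unary.Top using (View; view; ‵fromℕ; ‵inject₁)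
open import Data.Integer.Base using (+_)
import Data.Integer.Base as ℤ
import Data.Integer.Properties as ℤₚ
open import Data.Nat.Base using (ℕ; zero; suc; pred; NonZero; _≤_; z≤n; s≤s; _!)
open import Data.Nat.Combinatorics.Base using (_P′_)
import Data.Nat.Base as ℕ
import Data.Nat.Properties as ℕₚ
open import Data.Product.Base using (_×_; _,_; proj₁; proj₂; ∃-syntax)
open import Data.Rational.Base using (ℚ; 0ℚ; 1ℚ; _+_; _*_; -_; _-_; _/_; 1/_; Positive)
import Data.Rational.Properties as ℚₚ
open import Data.Rational.Solver using (module +-*-Solver)
import Data.Rational.Unnormalised.Base as ℚᵘ
import Data.Rational.Unnormalised.Properties as ℚᵘₚ
open import Data.Vec.Base using ([]; _∷_; lookup; updateAt)
import Data.Vec.Properties as Vecₚ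
open import Function.Base using (_∘_; id; case_of_)
open import Relation.Binary.PropositionalEquality
open import Relation.Nullary using (yes; no; does; contradiction)
open import Relation.Nullary.Decidable using (dec-true; dec-false)

open import Algebra.Bundles using (CommutativeRing)
open import Algebra.Properties.Semiring.Sum
  (CommutativeRing.semiring ℚₚ.+-*-commutativeRing)
  using (sum; sum-cong-≗; *-distribʳ-sum)

open ≡-Reasoning
open Admissible

Λ-space : ℕ → VectorSpace
Λ-space d = Sl₂Module.vectorSpace (Λ d)

-- Arithmetic of rational numbers and the embedding of the integers.

*-cancelˡ-pos : ∀ r .{{_ : Positive r}} {p q} → r * p ≡ r * q → p ≡ q
*-cancelˡ-pos r eq = ℚₚ.≤-antisym
  (ℚₚ.*-cancelˡ-≤-pos r (ℚₚ.≤-reflexive eq))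
  (ℚₚ.*-cancelˡ-≤-pos r (ℚₚ.≤-reflexive (sym eq)))

fromℤ-* : ∀ i j → fromℤ (i ℤ.* j) ≡ fromℤ i * fromℤ j
fromℤ-* i j = ℚₚ.toℚᵘ-injective (ℚᵘₚ.≃-trans (ℚₚ.toℚᵘ-fromℚᵘ (ℚᵘ.mkℚᵘ (i ℤ.* j) 0))
  (ℚᵘₚ.≃-sym (ℚᵘₚ.≃-trans (ℚₚ.toℚᵘ-homo-* (fromℤ i) (fromℤ j))
    (ℚᵘₚ.*-cong (ℚₚ.toℚᵘ-fromℚᵘ (ℚᵘ.mkℚᵘ i 0)) (ℚₚ.toℚᵘ-fromℚᵘ (ℚᵘ.mkℚᵘ j 0))))))

fromℕ-* : ∀ m n → fromℕ (m ℕ.* n) ≡ fromℕ m * fromℕ n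
fromℕ-* m n = trans (cong fromℤ (ℤₚ.pos-* m n)) (fromℤ-* (+ m) (+ n))

fromℕ-∸ : ∀ {m n} → n ≤ m → fromℕ (m ℕ.∸ n) ≡ fromℕ m - fromℕ n
fromℕ-∸ {m} {n} n≤m = begin
  fromℕ (m ℕ.∸ n)                     ≡⟨ solve 2 (λ x y → x := (x :+ y) :- y) refl (fromℕ (m ℕ.∸ n)) (fromℕ n) ⟩
  fromℕ (m ℕ.∸ n) + fromℕ n - fromℕ n ≡⟨ cong (_- fromℕ n) (fromℤ-+ (+ (m ℕ.∸ n)) (+ n)) ⟨
  fromℕ (m ℕ.∸ n ℕ.+ n) - fromℕ n     ≡⟨ cong (λ k → fromℕ k - fromℕ n) (ℕₚ.m∸n+n≡m n≤m) ⟩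
  fromℕ m - fromℕ n                   ∎
  where open +-*-Solver

*-/-cancel : ∀ n .{{_ : NonZero n}} i → fromℕ n * (i / n) ≡ fromℤ i
*-/-cancel (suc n) i = ℚₚ.toℚᵘ-injective
  (ℚᵘₚ.≃-trans (ℚₚ.toℚᵘ-homo-* (fromℕ (suc n)) (i / suc n))
  (ℚᵘₚ.≃-trans (ℚᵘₚ.*-cong (ℚₚ.toℚᵘ-fromℚᵘ (ℚᵘ.mkℚᵘ (+ suc n) 0)) (ℚₚ.toℚᵘ-fromℚᵘ (ℚᵘ.mkℚᵘ i n)))
  (ℚᵘₚ.≃-trans (ℚᵘ.*≡* eq) (ℚᵘₚ.≃-sym (ℚₚ.toℚᵘ-fromℚᵘ (ℚᵘ.mkℚᵘ i 0))))))
  where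
  eq : (+ suc n ℤ.* i) ℤ.* + 1 ≡ i ℤ.* (+ 1 ℤ.* + suc n)
  eq = begin
    (+ suc n ℤ.* i) ℤ.* + 1 ≡⟨ ℤₚ.*-identityʳ (+ suc n ℤ.* i) ⟩
    + suc n ℤ.* i           ≡⟨ ℤₚ.*-comm (+ suc n) i ⟩
    i ℤ.* + suc n           ≡⟨ cong (i ℤ.*_) (ℤₚ.*-identityˡ (+ suc n)) ⟨
    i ℤ.* (+ 1 ℤ.* + suc n) ∎

-- Squarefree monomials and their degrees.

Binary : ∀ {d} → Exponent d → Set
Binary α = ∀ k → lookup α k ≤ 1

binary-update : ∀ {d} (α : Exponent d) k s → Binary α → s (lookup α k) ≤ 1 → Binary (updateAt α k s)
binary-update (a ∷ α) zero    s bin s≤1 zero    = s≤1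
binary-update (a ∷ α) zero    s bin s≤1 (suc j) = bin (suc j)
binary-update (a ∷ α) (suc k) s bin s≤1 zero    = bin zero
binary-update (a ∷ α) (suc k) s bin s≤1 (suc j) = binary-update α k s (bin ∘ suc) s≤1 j

degree-suc : ∀ {d} (α : Exponent d) k → degree (updateAt α k suc) ≡ suc (degree α)
degree-suc (a ∷ α) zero    = refl
degree-suc (a ∷ α) (suc k) = trans (cong (a ℕ.+_) (degree-suc α k)) (ℕₚ.+-suc a (degree α))

-- Lowering a positive entry is undone by `suc`, so `degree-suc` applies to the lowered exponent.
degree-pred : ∀ {d} (α : Exponent d) k {n} → lookup α k ≡ suc n →
              degree (updateAt α k pred) ≡ pred (degree α)
degree-pred α k eq = cong pred (trans (sym (degree-suc (updateAt α k pred) k))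
                                      (cong degree (suc-pred-at α k eq)))

degree-binary : ∀ {d} (α : Exponent d) → Binary α → degree α ≤ d
degree-binary []      bin = z≤n
degree-binary (a ∷ α) bin = ℕₚ.+-mono-≤ (bin zero) (degree-binary α (bin ∘ suc))

-- The exponent of x₁ ⋯ xᵢ (of x₁ ⋯ x_d if i > d).
leading : ∀ d → ℕ → Exponent d
leading zero    i       = []
leading (suc d) zero    = 0 ∷ leading d zero
leading (suc d) (suc i) = 1 ∷ leading d i

leading-binary : ∀ d i → Binary (leading d i)
leading-binary (suc d) zero    zero    = z≤n
leading-binary (suc d) zero    (suc k) = leading-binary d zero k
leading-binary (suc d) (suc i) zero    = s≤s z≤n
leading-binary (suc d) (suc i) (suc k) = leading-binary d i k

degree-leading : ∀ {d i} → i ≤ d → degree (leading d i) ≡ i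
degree-leading {zero}  z≤n       = refl
degree-leading {suc d} z≤n       = degree-leading {d} z≤n
degree-leading {suc d} (s≤s i≤d) = cong suc (degree-leading i≤d)

-- Symmetric functions are determined on leading monomials.

Invariant : ∀ {d} → (Exponent d → ℚ) → Set
Invariant f = ∀ σ α → f (pull σ α) ≡ f α

-- A permutation of the remaining variables extends to all of them by fixing the first, which is
-- `lift₀`.
invariant-∷ : ∀ {d} a {f : Exponent (suc d) → ℚ} → Invariant f → Invariant (f ∘ (a ∷_))
invariant-∷ a inv σ α = inv (lift₀ σ) (a ∷ α)

invariant-swap : ∀ {d} {f : Exponent (suc (suc d)) → ℚ} → Invariant f →
                 ∀ a b α → f (b ∷ a ∷ α) ≡ f (a ∷ b ∷ α)
invariant-swap {f = f} inv a b α =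
  -- `pull` rebuilds the untouched tail as a table of its entries, hence the rewriting of `α`.
  trans (cong (λ γ → f (b ∷ a ∷ γ)) (sym (Vecₚ.tabulate∘lookup α))) (inv (swap Perm.id) (a ∷ b ∷ α))

-- Adjacent swaps carry the 0 past the ones, one at a time. The bound keeps `leading d i` from being
-- cut off at `d` ones, so both sides have the same degree.
invariant-0∷leading : ∀ {d i} {f : Exponent (suc d) → ℚ} → Invariant f → i ≤ d →
                      f (0 ∷ leading d i) ≡ f (leading (suc d) i)
invariant-0∷leading inv z≤n = refl
invariant-0∷leading {suc d} {suc i} {f} inv (s≤s i≤d) =
  trans (invariant-swap {f = f} inv 1 0 (leading d i))
        (invariant-0∷leading {f = f ∘ (1 ∷_)} (invariant-∷ 1 inv) i≤d)

-- Insertion sort: once the tail is sorted, a head 1 is already in place and a head 0 is moved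
-- behind the ones.
invariant-leading : ∀ {d} {f : Exponent d → ℚ} → Invariant f →
                    ∀ α → Binary α → f α ≡ f (leading d (degree α))
invariant-leading inv [] bin = refl
invariant-leading {f = f} inv (a ∷ α) bin with a | bin zero
... | 0 | _ = trans (invariant-leading (invariant-∷ 0 inv) α (bin ∘ suc))
                    (invariant-0∷leading inv (degree-binary α (bin ∘ suc)))
... | 1 | _ = invariant-leading (invariant-∷ 1 inv) α (bin ∘ suc)
... | suc (suc _) | s≤s ()

-- Binary exponents are handled by symmetry; on all others both functions vanish.
admissible-ext : ∀ {d} {f g : Exponent d → ℚ} → Admissible f → Admissible g →
  (∀ (i : Fin (suc d)) → f (leading d (toℕ i)) ≡ g (leading d (toℕ i))) → f ≗ g
admissible-ext {d} {f} {g} af ag eq α with Finₚ.any? (λ k → 2 ℕₚ.≤? lookup α k)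
... | yes (k , 2≤αₖ) = trans (af .vanishing α k 2≤αₖ) (sym (ag .vanishing α k 2≤αₖ))
... | no  ¬2≤       = begin
  f α                      ≡⟨ invariant-leading (af .invariant) α bin ⟩
  f (leading d (degree α)) ≡⟨ subst (λ i → f (leading d i) ≡ g (leading d i))
                                (Finₚ.toℕ-fromℕ< deg<) (eq (fromℕ< deg<)) ⟩
  g (leading d (degree α)) ≡⟨ invariant-leading (ag .invariant) α bin ⟨
  g α                      ∎
  where
  bin : Binary α
  bin k = ℕₚ.≤-pred (ℕₚ.≰⇒> λ 2≤ → ¬2≤ (k , 2≤))
  deg< : degree α ℕ.< suc d
  deg< = s≤s (degree-binary α bin)

-- The three operators at squarefree exponents.

sum-affine : ∀ {d} a b (α : Exponent d) →
  sum (λ k → a * fromℕ (lookup α k) + b) ≡ a * fromℕ (degree α) + fromℕ d * b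
sum-affine a b [] = solve 2 (λ a b → con 0ℚ := a :* con 0ℚ :+ con 0ℚ :* b) refl a b
  where open +-*-Solver
sum-affine {suc d} a b (m ∷ α) = begin
  a * fromℕ m + b + sum (λ k → a * fromℕ (lookup α k) + b)
    ≡⟨ cong (λ x → a * fromℕ m + b + x) (sum-affine a b α) ⟩
  a * fromℕ m + b + (a * fromℕ (degree α) + fromℕ d * b)
    ≡⟨ solve 5 (λ a b m n d → a :* m :+ b :+ (a :* n :+ d :* b) := a :* (m :+ n) :+ (con 1ℚ :+ d) :* b)
         refl a b (fromℕ m) (fromℕ (degree α)) (fromℕ d) ⟩
  a * (fromℕ m + fromℕ (degree α)) + (1ℚ + fromℕ d) * b
    ≡⟨ cong₂ (λ x y → a * x + y * b) (fromℤ-+ (+ m) (+ degree α)) (fromℕ-suc d) ⟨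
  a * fromℕ (m ℕ.+ degree α) + fromℕ (suc d) * b ∎
  where open +-*-Solver

module _ {d} {f : Exponent d → ℚ} (adm : Admissible f) (α : Exponent d) (bin : Binary α) where
  private
    f-degree : ∀ {n} (β : Exponent d) → Binary β → degree β ≡ n → f β ≡ f (leading d n)
    f-degree β binβ refl = invariant-leading (adm .invariant) β binβ

    -- At the exponents 0 and 1 any weight agrees with an affine one, and by symmetry every shifted
    -- coefficient that survives equals the same leading coefficient. The sum over the variables
    -- then depends only on the degree and on `d`.
    D-affine : ∀ w s a b n →
      (∀ k → w (lookup α k) * f (updateAt α k s) ≡ (a * fromℕ (lookup α k) + b) * f (leading d n)) →
      D w s f α ≡ (a * fromℕ (degree α) + fromℕ d * b) * f (leading d n)
    D-affine w s a b n term = begin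
      D w s f α
        ≡⟨ sum-cong-≗ term ⟩
      sum (λ k → (a * fromℕ (lookup α k) + b) * f (leading d n))
        ≡⟨ *-distribʳ-sum (f (leading d n)) (λ k → a * fromℕ (lookup α k) + b) ⟨
      sum (λ k → a * fromℕ (lookup α k) + b) * f (leading d n)
        ≡⟨ cong (_* f (leading d n)) (sum-affine a b α) ⟩
      (a * fromℕ (degree α) + fromℕ d * b) * f (leading d n) ∎

  -- The weight `wE₊` is 0 at 0 and 1 at 1, so it is the identity there: slope 1, constant 0.
  D-E₊ : D wE₊ pred f α ≡ fromℕ (degree α) * f (leading d (pred (degree α)))
  D-E₊ = trans (D-affine wE₊ pred 1ℚ 0ℚ (pred (degree α)) (λ k → term k (lookup α k) refl))
    (cong (_* g) (solve 2 (λ n d → con 1ℚ :* n :+ d :* con 0ℚ := n) refl (fromℕ (degree α)) (fromℕ d)))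
    where
    open +-*-Solver
    g = f (leading d (pred (degree α)))
    term : ∀ k n → lookup α k ≡ n →
           wE₊ n * f (updateAt α k pred) ≡ (1ℚ * fromℕ n + 0ℚ) * g
    term k 0 eq = trans (ℚₚ.*-zeroˡ (f (updateAt α k pred))) (sym (ℚₚ.*-zeroˡ g))
    term k 1 eq = cong (1ℚ *_) (f-degree (updateAt α k pred)
      (binary-update α k pred bin (ℕₚ.≤-trans ℕₚ.pred[n]≤n (bin k))) (degree-pred α k eq))
    term k (suc (suc n)) eq = contradiction (subst (_≤ 1) eq (bin k)) λ { (s≤s ()) }

  D-H : D wH id f α ≡ (fromℕ 2 * fromℕ (degree α) - fromℕ d) * f (leading d (degree α))
  D-H = trans (D-affine wH id (fromℕ 2) (- 1ℚ) (degree α) term)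
    (cong (_* f (leading d (degree α)))
      (solve 2 (λ n d → con (fromℕ 2) :* n :+ d :* con (- 1ℚ) := con (fromℕ 2) :* n :- d)
             refl (fromℕ (degree α)) (fromℕ d)))
    where
    open +-*-Solver
    term : ∀ k → wH (lookup α k) * f (updateAt α k id) ≡ wH (lookup α k) * f (leading d (degree α))
    term k = cong (wH (lookup α k) *_)
      (trans (cong f (Vecₚ.updateAt-id k α)) (f-degree α bin refl))

  -- Only variables with exponent 0 contribute, each with weight 1; this is counted by slope -1 and
  -- constant 1.
  D-E₋ : D wE₋ suc f α ≡ (fromℕ d - fromℕ (degree α)) * f (leading d (suc (degree α)))
  D-E₋ = trans (D-affine wE₋ suc (- 1ℚ) 1ℚ (suc (degree α)) (λ k → term k (lookup α k) refl))
    (cong (_* g) (solve 2 (λ n d → con (- 1ℚ) :* n :+ d :* con 1ℚ := d :- n) refl (fromℕ (degree α)) (fromℕ d)))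
    where
    open +-*-Solver
    g = f (leading d (suc (degree α)))
    term : ∀ k n → lookup α k ≡ n →
           wE₋ n * f (updateAt α k suc) ≡ (- 1ℚ * fromℕ n + 1ℚ) * g
    term k 0 eq = cong (1ℚ *_) (f-degree (updateAt α k suc)
      (binary-update α k suc bin (subst (λ n → suc n ≤ 1) (sym eq) (s≤s z≤n))) (degree-suc α k))
    -- Raising this exponent gives 2, where `f` vanishes; so the actual weight 2 may be replaced by
    -- the affine value 0.
    term k 1 eq = trans
      (trans (cong (wE₋ 1 *_) (adm .vanishing (updateAt α k suc) k
               (subst (2 ≤_) (sym (trans (Vecₚ.lookup∘updateAt k α) (cong suc eq))) (s≤s (s≤s z≤n)))))
             (ℚₚ.*-zeroʳ (wE₋ 1)))
      (sym (ℚₚ.*-zeroˡ g))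
    term k (suc (suc n)) eq = contradiction (subst (_≤ 1) eq (bin k)) λ { (s≤s ()) }

-- Coefficients of the elementary symmetric polynomials.

∏-≤1?-binary : ∀ {d} (α : Exponent d) → Binary α → ℚ∏.sum (λ k → ≤1? (lookup α k)) ≡ 1ℚ
∏-≤1?-binary []      bin = refl
∏-≤1?-binary (a ∷ α) bin with a | bin zero
... | 0 | _ = trans (ℚₚ.*-identityˡ _) (∏-≤1?-binary α (bin ∘ suc))
... | 1 | _ = trans (ℚₚ.*-identityˡ _) (∏-≤1?-binary α (bin ∘ suc))
... | suc (suc _) | s≤s ()

coeff-elementary : ∀ {d} i (α : Exponent d) → Binary α →
  coeff (elementary d i) α ≡ (if does (degree α ℕₚ.≟ i) then 1ℚ else 0ℚ)
coeff-elementary {d} i α bin = trans (coeff-filter i (subsets d) α)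
  (cong (λ x → if does (degree α ℕₚ.≟ i) then x else 0ℚ)
    (trans (coeff-subsets d α) (∏-≤1?-binary α bin)))

-- Coordinates on the space of symmetric multiaffine polynomials.

module _ (d : ℕ) where
  open Sl₂Module (Λ d) using () renaming (Carrierᴹ to Λᶜ; _≈ᴹ_ to _≈Λ_)

  coordinate : Λᶜ → Fin (suc d) → ℚ
  coordinate (p , _) i = coeff p (leading d (toℕ i))

  -- Reduces an equality in `Λ d` to `d + 1` equalities of rational numbers; the equivariance proofs
  -- start from it.
  coordinate-ext : ∀ x y → coordinate x ≗ coordinate y → x ≈Λ y
  coordinate-ext (p , p∈Λ) (q , q∈Λ) = admissible-ext (admissible p p∈Λ) (admissible q q∈Λ)

  degree-index : ∀ (i : Fin (suc d)) → degree (leading d (toℕ i)) ≡ toℕ i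
  degree-index i = degree-leading (Finₚ.toℕ≤pred[n] i)

  -- The reciprocal of the binomial coefficient `d` over `i`, written as in `w` but uniformly in
  -- `i`, with value 1 at `i = 0`.
  scale : Fin (suc d) → ℚ
  scale i = (+ (toℕ i !)) / (d P′ toℕ i)
    where instance _ = P′-nonZero d (toℕ i) (Finₚ.toℕ≤pred[n] i)

  scale-positive : ∀ i → Positive (scale i)
  scale-positive i = ℚₚ.normalize-pos (toℕ i !) (d P′ toℕ i)
    where instance
      _ = P′-nonZero d (toℕ i) (Finₚ.toℕ≤pred[n] i)
      _ = (toℕ i) ℕₚ.!≢0

  P′-*-scale : ∀ i → fromℕ (d P′ toℕ i) * scale i ≡ fromℕ (toℕ i !)
  P′-*-scale i = *-/-cancel (d P′ toℕ i) (+ (toℕ i !))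
    where instance _ = P′-nonZero d (toℕ i) (Finₚ.toℕ≤pred[n] i)

  -- After multiplication by the falling factorial `d P′ i` both sides equal `(i + 1)!`: on the left
  -- the factor `d - i` extends it to `d P′ (i + 1)`, on the right it cancels the denominator of
  -- `scale (inject₁ i)`.
  scale-suc : ∀ (i : Fin d) →
    (fromℕ d - fromℕ (toℕ i)) * scale (suc i) ≡ fromℕ (suc (toℕ i)) * scale (inject₁ i)
  scale-suc i = *-cancelˡ-pos P {{P-positive}} (begin
    P * ((fromℕ d - fromℕ n) * S)
      ≡⟨ solve 3 (λ P x S → P :* (x :* S) := x :* P :* S) refl P (fromℕ d - fromℕ n) S ⟩
    (fromℕ d - fromℕ n) * P * S
      ≡⟨ cong (λ x → x * P * S) (fromℕ-∸ (ℕₚ.<⇒≤ (Finₚ.toℕ<n i))) ⟨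
    fromℕ (d ℕ.∸ n) * P * S
      ≡⟨ cong (_* S) (fromℕ-* (d ℕ.∸ n) (d P′ n)) ⟨
    fromℕ (d P′ suc n) * S
      ≡⟨ P′-*-scale (suc i) ⟩
    fromℕ (suc n !)
      ≡⟨ fromℕ-* (suc n) (n !) ⟩
    fromℕ (suc n) * fromℕ (n !)
      ≡⟨ cong (fromℕ (suc n) *_) (subst (λ m → fromℕ (d P′ m) * S′ ≡ fromℕ (m !))
           (Finₚ.toℕ-inject₁ i) (P′-*-scale (inject₁ i))) ⟨
    fromℕ (suc n) * (P * S′)
      ≡⟨ solve 3 (λ x P S → x :* (P :* S) := P :* (x :* S)) refl (fromℕ (suc n)) P S′ ⟩
    P * (fromℕ (suc n) * S′) ∎)
    where
    open +-*-Solver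
    n = toℕ i
    P = fromℕ (d P′ n)
    S = scale (suc i)
    S′ = scale (inject₁ i)
    P-positive : Positive P
    P-positive = ℚₚ.normalize-pos (d P′ n) 1 {{_}} {{P′-nonZero d n (ℕₚ.<⇒≤ (Finₚ.toℕ<n i))}}

  coeff-w : ∀ i α → coeff (proj₁ (w d i)) α ≡ scale i * coeff (elementary d (toℕ i)) α
  coeff-w zero    α = sym (ℚₚ.*-identityˡ _)
  coeff-w (suc i) α = coeff-· (scale (suc i)) (elementary d (suc (toℕ i))) α

  -- The monomial `leading d j` has degree `j`, so it occurs in the elementary polynomial of degree
  -- `i`, with coefficient 1, exactly when `i = j`.
  coordinate-w : ∀ i j → coordinate (w d i) j ≡ scale i * v (+ toℕ i) j
  coordinate-w i j = trans (coeff-w i (leading d (toℕ j))) (cong (scale i *_)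
    (trans (coeff-elementary (toℕ i) (leading d (toℕ j)) (leading-binary d (toℕ j)))
      (trans (cong (λ n → if does (n ℕₚ.≟ toℕ i) then 1ℚ else 0ℚ) (degree-index j)) δ≡v)))
    where
    δ≡v : (if does (toℕ j ℕₚ.≟ toℕ i) then 1ℚ else 0ℚ) ≡ v (+ toℕ i) j
    δ≡v = case toℕ j ℕₚ.≟ toℕ i of λ where
      (yes eq) → trans (cong (if_then 1ℚ else 0ℚ) (dec-true (toℕ j ℕₚ.≟ toℕ i) eq))
                       (sym (v-same (+ toℕ i) j (cong +_ (sym eq))))
      (no neq) → trans (cong (if_then 1ℚ else 0ℚ) (dec-false (toℕ j ℕₚ.≟ toℕ i) neq))
                       (sym (v-diff (+ toℕ i) j (neq ∘ sym ∘ ℤₚ.+-injective)))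

  coeff-linearCombination : ∀ {n} (b : Fin n → Λᶜ) c α →
    coeff (proj₁ (linearCombination (Λ-space d) b c)) α ≡ sum λ i → c i * coeff (proj₁ (b i)) α
  coeff-linearCombination {zero}  b c α = refl
  coeff-linearCombination {suc n} b c α = trans
    (coeff-++ (c zero · proj₁ (b zero)) (proj₁ (linearCombination (Λ-space d) (b ∘ suc) (c ∘ suc))) α)
    (cong₂ _+_ (coeff-· (c zero) (proj₁ (b zero)) α) (coeff-linearCombination (b ∘ suc) (c ∘ suc) α))

  -- The linear isomorphism and the basis.

  -- A vector of `V d` is its own family of coordinates, so this is the linear extension of the
  -- assignment confirmed in `φ-v`.
  φ : (Fin (suc d) → ℚ) → Λᶜ
  φ = linearCombination (Λ-space d) (w d)

  -- In coordinates `φ` is a diagonal matrix with positive entries; injectivity and the inverse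
  -- follow by cancelling or dividing entrywise.
  coordinate-φ : ∀ f j → coordinate (φ f) j ≡ f j * scale j
  coordinate-φ f j = begin
    coordinate (φ f) j
      ≡⟨ coeff-linearCombination (w d) f (leading d (toℕ j)) ⟩
    sum (λ i → f i * coordinate (w d i) j)
      ≡⟨ sum-cong-≗ (λ i → trans (cong (f i *_) (coordinate-w i j))
                                 (sym (ℚₚ.*-assoc (f i) (scale i) (v (+ toℕ i) j)))) ⟩
    sum (λ i → f i * scale i * v (+ toℕ i) j)
      ≡⟨ sum-single _ j (λ i i≢j → trans
           (cong (f i * scale i *_) (v-diff (+ toℕ i) j (i≢j ∘ Finₚ.toℕ-injective ∘ ℤₚ.+-injective)))
           (ℚₚ.*-zeroʳ (f i * scale i))) ⟩
    f j * scale j * v (+ toℕ j) j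
      ≡⟨ cong (f j * scale j *_) (v-same (+ toℕ j) j refl) ⟩
    f j * scale j * 1ℚ
      ≡⟨ ℚₚ.*-identityʳ (f j * scale j) ⟩
    f j * scale j ∎

  φ-cong : ∀ {f g} → f ≗ g → φ f ≈Λ φ g
  φ-cong {f} {g} f≗g = coordinate-ext (φ f) (φ g) λ i →
    trans (coordinate-φ f i) (trans (cong (_* scale i) (f≗g i)) (sym (coordinate-φ g i)))

  φ-linear : IsLinear (vSpace d) (Λ-space d) φ
  φ-linear = isLinear (vSpace d) (Λ-space d) φ φ-cong
    (λ f g → coordinate-ext (φ (λ i → f i + g i)) (φ f +ᴹ φ g) λ i →
      trans (coordinate-φ (λ i → f i + g i) i)
      (trans (ℚₚ.*-distribʳ-+ (scale i) (f i) (g i))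
      (trans (sym (cong₂ _+_ (coordinate-φ f i) (coordinate-φ g i)))
             (sym (coeff-++ (proj₁ (φ f)) (proj₁ (φ g)) (leading d (toℕ i)))))))
    (λ c f → coordinate-ext (φ (λ i → c * f i)) (c *ₗ φ f) λ i →
      trans (coordinate-φ (λ i → c * f i) i)
      (trans (ℚₚ.*-assoc c (f i) (scale i))
      (trans (cong (c *_) (sym (coordinate-φ f i)))
             (sym (coeff-· c (proj₁ (φ f)) (leading d (toℕ i)))))))
    where open Sl₂Module (Λ d) using (_+ᴹ_; _*ₗ_)

  φ-injective : ∀ {f g} → φ f ≈Λ φ g → f ≗ g
  φ-injective {f} {g} φf≈φg i = *-cancelˡ-pos (scale i) {{scale-positive i}} (begin
    scale i * f i      ≡⟨ ℚₚ.*-comm (scale i) (f i) ⟩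
    f i * scale i      ≡⟨ coordinate-φ f i ⟨
    coordinate (φ f) i ≡⟨ φf≈φg (leading d (toℕ i)) ⟩
    coordinate (φ g) i ≡⟨ coordinate-φ g i ⟩
    g i * scale i      ≡⟨ ℚₚ.*-comm (g i) (scale i) ⟩
    scale i * g i      ∎)

  φ⁻¹ : Λᶜ → Fin (suc d) → ℚ
  φ⁻¹ x i = coordinate x i * 1/ scale i
    where instance _ = ℚₚ.pos⇒nonZero (scale i) {{scale-positive i}}

  φ-φ⁻¹ : ∀ x → φ (φ⁻¹ x) ≈Λ x
  φ-φ⁻¹ x = coordinate-ext (φ (φ⁻¹ x)) x λ i →
    let instance _ = ℚₚ.pos⇒nonZero (scale i) {{scale-positive i}} in begin
    coordinate (φ (φ⁻¹ x)) i               ≡⟨ coordinate-φ (φ⁻¹ x) i ⟩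
    coordinate x i * 1/ scale i * scale i  ≡⟨ ℚₚ.*-assoc (coordinate x i) (1/ scale i) (scale i) ⟩
    coordinate x i * (1/ scale i * scale i) ≡⟨ cong (coordinate x i *_) (ℚₚ.*-inverseˡ (scale i)) ⟩
    coordinate x i * 1ℚ                    ≡⟨ ℚₚ.*-identityʳ (coordinate x i) ⟩
    coordinate x i                         ∎

  w-isBasis : IsBasis (Λ-space d) (w d)
  w-isBasis = record
    -- The linear combination of the `w d i` is `φ c` by definition, so independence is injectivity
    -- of `φ` against the zero vector.
    { independent = λ c φc≈0 → φ-injective {c} {λ _ → 0ℚ} λ α → trans (φc≈0 α) (sym (0ᴹ-homo α))
    ; spanning    = λ x → φ⁻¹ x , λ α → sym (φ-φ⁻¹ x α)
    }
    where open IsLeftModuleHomomorphism φ-linear using (0ᴹ-homo)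

  φ-v : ∀ i → φ (v (+ toℕ i)) ≈Λ w d i
  φ-v i = coordinate-ext (φ (v (+ toℕ i))) (w d i) λ j →
    trans (coordinate-φ (v (+ toℕ i)) j) (trans (v-*-scale j) (sym (coordinate-w i j)))
    where
    v-*-scale : ∀ j → v (+ toℕ i) j * scale j ≡ scale i * v (+ toℕ i) j
    v-*-scale j with i Finₚ.≟ j
    ... | yes refl = ℚₚ.*-comm (v (+ toℕ i) i) (scale i)
    ... | no i≢j   = begin
      v (+ toℕ i) j * scale j ≡⟨ cong (_* scale j) v≡0 ⟩
      0ℚ * scale j            ≡⟨ ℚₚ.*-zeroˡ (scale j) ⟩
      0ℚ                      ≡⟨ ℚₚ.*-zeroʳ (scale i) ⟨
      scale i * 0ℚ            ≡⟨ cong (scale i *_) v≡0 ⟨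
      scale i * v (+ toℕ i) j ∎
      where
      v≡0 = v-diff (+ toℕ i) j (i≢j ∘ Finₚ.toℕ-injective ∘ ℤₚ.+-injective)

  -- Equivariance under the three operators.

  private
    module Λᵐ = Sl₂Module (Λ d)

    φ-admissible : ∀ f → Admissible (coeff (proj₁ (φ f)))
    φ-admissible f = admissible (proj₁ (φ f)) (proj₂ (φ f))

  -- In these coordinates `φ` and both versions of `h` are diagonal, and `h` has the same entries
  -- `2 j - d` on either side.
  φ-h : ∀ f → φ (VH d f) ≈Λ Λᵐ.h (φ f)
  φ-h f = coordinate-ext (φ (VH d f)) (Λᵐ.h (φ f)) λ j → begin
    coordinate (φ (VH d f)) j
      ≡⟨ coordinate-φ (VH d f) j ⟩
    VH d f j * scale j
      ≡⟨ cong (_* scale j) (VH-coord d f j) ⟩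
    (fromℕ 2 * fromℕ (toℕ j) - fromℕ d) * f j * scale j
      ≡⟨ ℚₚ.*-assoc (fromℕ 2 * fromℕ (toℕ j) - fromℕ d) (f j) (scale j) ⟩
    (fromℕ 2 * fromℕ (toℕ j) - fromℕ d) * (f j * scale j)
      ≡⟨ cong ((fromℕ 2 * fromℕ (toℕ j) - fromℕ d) *_) (coordinate-φ f j) ⟨
    (fromℕ 2 * fromℕ (toℕ j) - fromℕ d) * coordinate (φ f) j
      ≡⟨ cong (λ n → (fromℕ 2 * fromℕ n - fromℕ d) * coeff (proj₁ (φ f)) (leading d n)) (degree-index j) ⟨
    -- The omitted term is the right-hand side of `D-H`, with the degree of `leading d (toℕ j)` in
    -- place of `toℕ j`.
    _
      ≡⟨ D-H (φ-admissible f) (leading d (toℕ j)) (leading-binary d (toℕ j)) ⟨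
    D wH id (coeff (proj₁ (φ f))) (leading d (toℕ j))
      ≡⟨ polyH-D (proj₁ (φ f)) (leading d (toℕ j)) ⟨
    coordinate (Λᵐ.h (φ f)) j ∎

  coordinate-e₊ : ∀ f j → coordinate (Λᵐ.e₊ (φ f)) j
                            ≡ fromℕ (toℕ j) * coeff (proj₁ (φ f)) (leading d (pred (toℕ j)))
  coordinate-e₊ f j = trans (polyE₊-D (proj₁ (φ f)) (leading d (toℕ j)))
    (trans (D-E₊ (φ-admissible f) (leading d (toℕ j)) (leading-binary d (toℕ j)))
      (cong (λ n → fromℕ n * coeff (proj₁ (φ f)) (leading d (pred n))) (degree-index j)))

  -- At index `j = i + 1` both sides are multiples of the entry of `f` at `i`, and `scale-suc i`
  -- matches the factors.
  φ-e₊ : ∀ f → φ (VE₊ d f) ≈Λ Λᵐ.e₊ (φ f)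
  φ-e₊ f = coordinate-ext (φ (VE₊ d f)) (Λᵐ.e₊ (φ f)) λ j →
    trans (coordinate-φ (VE₊ d f) j)
      (trans (cong (_* scale j) (VE₊-coord d f j)) (trans (term j) (sym (coordinate-e₊ f j))))
    where
    open +-*-Solver
    term : ∀ j → (fromℕ d - fromℤ (+ toℕ j ℤ.- + 1)) * at f (+ toℕ j ℤ.- + 1) * scale j
               ≡ fromℕ (toℕ j) * coeff (proj₁ (φ f)) (leading d (pred (toℕ j)))
    -- The left side reads `f` at index -1, where `at` gives 0; on the right the factor `j = 0`
    -- annihilates the coefficient at the truncated predecessor.
    term zero = begin
      x * at f (+ 0 ℤ.- + 1) * scale zero ≡⟨ cong (λ y → x * y * scale zero) (at-out f (+ 0 ℤ.- + 1) λ _ ()) ⟩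
      x * 0ℚ * scale zero                 ≡⟨ solve 3 (λ x s y → x :* con 0ℚ :* s := con 0ℚ :* y) refl x (scale zero) y ⟩
      0ℚ * y                              ∎
      where
      x = fromℕ d - fromℤ (+ 0 ℤ.- + 1)
      y = coeff (proj₁ (φ f)) (leading d 0)
    term (suc i) = begin
      (fromℕ d - fromℕ n) * at f (+ n) * scale (suc i)
        ≡⟨ cong (λ y → (fromℕ d - fromℕ n) * y * scale (suc i))
             (trans (cong (at f ∘ +_) (sym (Finₚ.toℕ-inject₁ i))) (at-in f (inject₁ i))) ⟩
      (fromℕ d - fromℕ n) * F * scale (suc i)
        ≡⟨ solve 3 (λ x y z → x :* y :* z := y :* (x :* z)) refl (fromℕ d - fromℕ n) F (scale (suc i)) ⟩
      F * ((fromℕ d - fromℕ n) * scale (suc i))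
        ≡⟨ cong (F *_) (scale-suc i) ⟩
      F * (fromℕ (suc n) * scale (inject₁ i))
        ≡⟨ solve 3 (λ x y z → x :* (y :* z) := y :* (x :* z)) refl F (fromℕ (suc n)) (scale (inject₁ i)) ⟩
      fromℕ (suc n) * (F * scale (inject₁ i))
        ≡⟨ cong (fromℕ (suc n) *_) (coordinate-φ f (inject₁ i)) ⟨
      fromℕ (suc n) * coordinate (φ f) (inject₁ i)
        ≡⟨ cong (λ m → fromℕ (suc n) * coeff (proj₁ (φ f)) (leading d m)) (Finₚ.toℕ-inject₁ i) ⟩
      fromℕ (suc n) * coeff (proj₁ (φ f)) (leading d n) ∎
      where
      n = toℕ i
      F = f (inject₁ i)

  coordinate-e₋ : ∀ f j → coordinate (Λᵐ.e₋ (φ f)) j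
                            ≡ (fromℕ d - fromℕ (toℕ j)) * coeff (proj₁ (φ f)) (leading d (suc (toℕ j)))
  coordinate-e₋ f j = trans (polyE₋-D (proj₁ (φ f)) (leading d (toℕ j)))
    (trans (D-E₋ (φ-admissible f) (leading d (toℕ j)) (leading-binary d (toℕ j)))
      (cong (λ n → (fromℕ d - fromℕ n) * coeff (proj₁ (φ f)) (leading d (suc n))) (degree-index j)))

  -- Below the top index both sides are multiples of the entry of `f` at `j + 1`, and `scale-suc` is
  -- used in the opposite direction. The top index is split off by `view`.
  φ-e₋ : ∀ f → φ (VE₋ d f) ≈Λ Λᵐ.e₋ (φ f)
  φ-e₋ f = coordinate-ext (φ (VE₋ d f)) (Λᵐ.e₋ (φ f)) λ j →
    trans (coordinate-φ (VE₋ d f) j)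
      (trans (cong (_* scale j) (trans (VE₋-coord d f j)
                -- With the summand 1 in front, the integer index computes to `+ suc (toℕ j)`.
                (cong (λ k → fromℤ k * at f k) (ℤₚ.+-comm (+ toℕ j) (+ 1)))))
        (trans (term (view j)) (sym (coordinate-e₋ f j))))
    where
    open +-*-Solver
    term : ∀ {j} → View j → fromℕ (suc (toℕ j)) * at f (+ suc (toℕ j)) * scale j
               ≡ (fromℕ d - fromℕ (toℕ j)) * coeff (proj₁ (φ f)) (leading d (suc (toℕ j)))
    -- At `j = d` the index `d + 1` is out of range, so `at` gives 0, and the factor `d - j` on the
    -- right is 0 as well.
    term ‵fromℕ = begin
      x * at f (+ suc n) * s ≡⟨ cong (λ y → x * y * s) (at-out f (+ suc n) λ i eq →
                                  ℕₚ.<⇒≢ (Finₚ.toℕ<n i) (sym (trans (cong suc (sym (Finₚ.toℕ-fromℕ d))) (ℤₚ.+-injective eq)))) ⟩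
      x * 0ℚ * s             ≡⟨ solve 4 (λ x s d y → x :* con 0ℚ :* s := (d :- d) :* y) refl x s (fromℕ d) y ⟩
      (fromℕ d - fromℕ d) * y ≡⟨ cong (λ m → (fromℕ d - fromℕ m) * y) (Finₚ.toℕ-fromℕ d) ⟨
      (fromℕ d - fromℕ n) * y ∎
      where
      n = toℕ (Fin.fromℕ d)
      x = fromℕ (suc n)
      s = scale (Fin.fromℕ d)
      y = coeff (proj₁ (φ f)) (leading d (suc n))
    term (‵inject₁ i) = begin
      fromℕ (suc (toℕ (inject₁ i))) * at f (+ suc (toℕ (inject₁ i))) * S
        ≡⟨ cong (λ m → fromℕ (suc m) * at f (+ suc m) * S) (Finₚ.toℕ-inject₁ i) ⟩
      fromℕ (suc n) * at f (+ suc n) * S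
        ≡⟨ cong (λ y → fromℕ (suc n) * y * S) (at-in f (suc i)) ⟩
      fromℕ (suc n) * F * S
        ≡⟨ solve 3 (λ x y z → x :* y :* z := y :* (x :* z)) refl (fromℕ (suc n)) F S ⟩
      F * (fromℕ (suc n) * S)
        ≡⟨ cong (F *_) (scale-suc i) ⟨
      F * ((fromℕ d - fromℕ n) * scale (suc i))
        ≡⟨ solve 3 (λ x y z → x :* (y :* z) := y :* (x :* z)) refl F (fromℕ d - fromℕ n) (scale (suc i)) ⟩
      (fromℕ d - fromℕ n) * (F * scale (suc i))
        ≡⟨ cong ((fromℕ d - fromℕ n) *_) (coordinate-φ f (suc i)) ⟨
      (fromℕ d - fromℕ n) * coordinate (φ f) (suc i)
        ≡⟨ cong (λ m → (fromℕ d - fromℕ m) * coeff (proj₁ (φ f)) (leading d (suc m))) (Finₚ.toℕ-inject₁ i) ⟨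
      (fromℕ d - fromℕ (toℕ (inject₁ i))) * coeff (proj₁ (φ f)) (leading d (suc (toℕ (inject₁ i)))) ∎
      where
      n = toℕ i
      F = f (suc i)
      S = scale (inject₁ i)

  -- The isomorphism of modules and the theorem.

  φ-isSl₂Isomorphism : IsSl₂Isomorphism (V d) (Λ d) φ
  φ-isSl₂Isomorphism = record
    { isLinearIsomorphism = record
      { isLeftModuleMonomorphism = record
        { isLeftModuleHomomorphism = φ-linear
        ; injective                = φ-injective
        }
      -- Surjectivity between setoids asks for every `z` equal to the preimage, so `φ-cong` first
      -- passes from `z` to `φ⁻¹ y`.
      ; surjective = λ y → φ⁻¹ y , λ z≗ α → trans (φ-cong z≗ α) (φ-φ⁻¹ y α)
      }
    ; e₊-equivariant = φ-e₊
    ; h-equivariant  = φ-h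
    ; e₋-equivariant = φ-e₋
    }

theorem6 : (d : ℕ) → 1 ≤ d →
    IsBasis (Sl₂Module.vectorSpace (Λ d)) (w d)
    × ∃[ φ ] IsSl₂Isomorphism (V d) (Λ d) φ
             × (∀ i → Sl₂Module._≈ᴹ_ (Λ d) (φ (v (+ toℕ i))) (w d i))
theorem6 d _ = w-isBasis d , φ d , φ-isSl₂Isomorphism d , φ-v d
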